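{- For every claw-free bridgeless cubic graph $G$, $\nu_3(G) \geq \frac{43}{45}\cdot |E(G)|$.
   Context: Graphs are finite, without loops, possibly with multiple edges; a graph is cubic if every vertex has degree $3$, bridgeless if it has no edge whose removal increases the number of connected components, and claw-free if it has no induced subgraph isomorphic to $K_{1,3}$. $\nu_3(G)$ is the maximum number of edges of a $3$-edge-colorable subgraph of $G$. -}

module Defs where

open import Data.Fin using (Fin; zero; suc; finToFun; funToFin)
open import Data.Fin.Properties using (_≟_; any?; all?; finToFun-funToFin)
open import Data.Fin.Subset using (Subset; _∈_; ⊤; ⊥; ∣_∣; _-_)
open import Data.Fin.Subset.Properties using (_∈?_; ∣p∣≤n; ∣⊥∣≡0; ∉⊥; anySubset?)
open import Data.Nat using (ℕ; zero; suc; _≤_; _<_)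
open import Data.Nat.Properties using (≤-pred; ≤∧≢⇒<)
open import Data.Empty using (⊥-elim)
open import Data.Product using (∃-syntax; Σ-syntax; _×_; _,_; proj₁; proj₂)
open import Data.Sum using (_⊎_)
open import Data.Vec using (tabulate)
open import Function using (_⇔_; Injective; StrictlySurjective)
open import Relation.Binary.Construct.Closure.ReflexiveTransitive using (Star)
open import Relation.Binary.PropositionalEquality
  using (_≡_; _≢_; sym; trans)
open import Relation.Nullary using (¬_; Dec; yes; no; does)
open import Relation.Nullary.Decidable using (_⊎-dec_; _×-dec_; _→-dec_; ¬?; map′)
import Data.Nat as ℕ

-- Distinct edges may have the same ends.  The order of the two ends of an edge
-- carries no meaning.
record Graph : Set where
  field
    numV     : ℕ
    numE     : ℕ
    ends     : Fin numE → Fin numV × Fin numV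
    loopless : ∀ e → proj₁ (ends e) ≢ proj₂ (ends e)

module _ (G : Graph) where
  open Graph G

  Joins : Fin numE → Fin numV → Fin numV → Set
  Joins e u v = (ends e ≡ (u , v)) ⊎ (ends e ≡ (v , u))

  Incident : Fin numV → Fin numE → Set
  Incident v e = (proj₁ (ends e) ≡ v) ⊎ (proj₂ (ends e) ≡ v)

  incident? : ∀ v e → Dec (Incident v e)
  incident? v e = (proj₁ (ends e) ≟ v) ⊎-dec (proj₂ (ends e) ≟ v)

  edgesAt : Fin numV → Subset numE
  edgesAt v = tabulate (λ e → does (incident? v e))

  degree : Fin numV → ℕ
  degree v = ∣ edgesAt v ∣

  Cubic : Set
  Cubic = ∀ v → degree v ≡ 3

  -- A set F of edges also stands for the spanning subgraph (V(G), F).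

  Adjacent : Subset numE → Fin numV → Fin numV → Set
  Adjacent F u v = ∃[ e ] (e ∈ F × Joins e u v)

  Reachable : Subset numE → Fin numV → Fin numV → Set
  Reachable F = Star (Adjacent F)

  -- (V(G), F) has exactly k connected components: the vertices can be labelled
  -- by Fin k, using every label, so that the label classes are the components.
  HasComponents : Subset numE → ℕ → Set
  HasComponents F k =
    Σ[ c ∈ (Fin numV → Fin k) ]
      (StrictlySurjective _≡_ c × (∀ u v → (c u ≡ c v) ⇔ Reachable F u v))

  Bridge : Fin numE → Set
  Bridge e = ∃[ k ] ∃[ k′ ] (HasComponents ⊤ k × HasComponents (⊤ - e) k′ × k < k′)

  Bridgeless : Set
  Bridgeless = ∀ e → ¬ Bridge e

-- The graph H is isomorphic to the subgraph of G induced by the image of onV.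
record InducedCopy (H G : Graph) : Set where
  private
    module H = Graph H
    module G = Graph G
  field
    onV      : Fin H.numV → Fin G.numV
    onE      : Fin H.numE → Fin G.numE
    onV-inj  : Injective _≡_ _≡_ onV
    onE-inj  : Injective _≡_ _≡_ onE
    preserve : ∀ e → Joins G (onE e) (onV (proj₁ (H.ends e))) (onV (proj₂ (H.ends e)))
    induced  : ∀ f x y → Joins G f (onV x) (onV y) → ∃[ e ] onE e ≡ f

K₁,₃ : Graph
K₁,₃ = record
  { numV     = 4
  ; numE     = 3
  ; ends     = λ e → zero , suc e
  ; loopless = λ _ ()
  }

ClawFree : Graph → Set
ClawFree G = ¬ InducedCopy K₁,₃ G

module _ (G : Graph) where
  open Graph G

  -- Only the values of c on F matter.
  ProperOn : Subset numE → (Fin numE → Fin 3) → Set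
  ProperOn F c = ∀ v e f → e ∈ F → f ∈ F → e ≢ f →
    Incident G v e → Incident G v f → c e ≢ c f

  -- Neither the colourability nor the number of edges of a subgraph depends on
  -- which isolated vertices it has, so its edge set F suffices.
  ThreeEdgeColourable : Subset numE → Set
  ThreeEdgeColourable F = ∃[ c ] ProperOn F c

  IsMaxThreeEdgeColourable : ℕ → Set
  IsMaxThreeEdgeColourable k =
    (∃[ F ] (ThreeEdgeColourable F × ∣ F ∣ ≡ k)) ×
    (∀ F → ThreeEdgeColourable F → ∣ F ∣ ≤ k)

  abstract
    properOn? : ∀ F c → Dec (ProperOn F c)
    properOn? F c = all? λ v → all? λ e → all? λ f →
      (e ∈? F) →-dec ((f ∈? F) →-dec (¬? (e ≟ f) →-dec
      (incident? G v e →-dec (incident? G v f →-dec ¬? (c e ≟ c f)))))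

    threeEdgeColourable? : ∀ F → Dec (ThreeEdgeColourable F)
    threeEdgeColourable? F = map′
      (λ (i , p) → finToFun i , p)
      (λ (c , p) → funToFin c , λ v e f e∈F f∈F e≢f ve vf eq →
        p v e f e∈F f∈F e≢f ve vf
          (trans (sym (finToFun-funToFin c e)) (trans eq (finToFun-funToFin c f))))
      (any? λ i → properOn? F (finToFun {3} {numE} i))

    maxThreeEdgeColourable : ∃[ k ] IsMaxThreeEdgeColourable k
    maxThreeEdgeColourable = search numE (λ F _ → ∣p∣≤n F)
      where
      search : ∀ n → (∀ F → ThreeEdgeColourable F → ∣ F ∣ ≤ n) →
               ∃[ k ] IsMaxThreeEdgeColourable k
      search n bound
        with anySubset? (λ F → threeEdgeColourable? F ×-dec (∣ F ∣ ℕ.≟ n))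
      ... | yes attained = n , attained , bound
      search zero bound | no none = ⊥-elim (none
        (⊥ , ((λ _ → zero) , λ _ _ _ e∈⊥ → ⊥-elim (∉⊥ e∈⊥)) , ∣⊥∣≡0 numE))
      search (suc n) bound | no none = search n λ F col →
        ≤-pred (≤∧≢⇒< (bound F col) (λ eq → none (F , col , eq)))

  ν₃ : ℕ
  ν₃ = proj₁ maxThreeEdgeColourable

  ν₃-isMax : IsMaxThreeEdgeColourable ν₃
  ν₃-isMax = proj₂ maxThreeEdgeColourable

{-# OPTIONS --safe #-}

-- Let the three darts at each vertex of a cubic graph carry distinct colours, and call an edge lost
-- when its two darts disagree.  When a digon is suppressed or a triangle is contracted, a colouring of
-- the smaller graph lifts without further lost edges.  In a claw-free graph every vertex lies in a
-- digon or a triangle, so these reductions lead to a bridgeless cubic graph H without digons and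
-- triangles, each of whose vertices stands for at least three vertices of G.  By Petersen's theorem
-- H has a 2-factor; its odd cycles have length at least 5 and cost one lost edge each, hence at most
-- |V(H)|/5 ≤ |V(G)|/15 = 2|E(G)|/45 edges are lost.  Petersen's theorem follows from Frink's
-- reduction: when the ends of an edge are deleted, one of the two ways of joining their four
-- remaining neighbours in pairs creates no bridge.

module Submission where

open import Defs
open import Data.Bool using (Bool; true; false; not; if_then_else_; _∧_)
import Data.Bool.Properties as Bool
open import Data.Empty using (⊥-elim)
open import Data.Fin using (Fin; zero; suc; punchIn; punchOut)
open import Data.Fin.Patterns using (0F; 1F; 2F)
open import Data.Fin.Permutation as Perm
  using (Permutation; _⟨$⟩ʳ_; _⟨$⟩ˡ_; inverseˡ; inverseʳ; transpose)
open import Data.Fin.Properties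
  using (_≟_; suc-injective; any?; all?; punchIn-punchOut; punchOut-punchIn; punchOut-injective;
         punchOut-cong; punchInᵢ≢i)
open import Data.Fin.Subset using (Subset; inside; outside; ∣_∣; _-_; ⊤) renaming (_∈_ to _∈ₛ_)
open import Data.Fin.Subset.Properties using (anySubset?; ∈⊤; x∈p∧x≢y⇒x∈p-y)
import Data.Integer as ℤ
import Data.Integer.Properties as ℤ
open import Data.List using (List; []; _∷_; filter; allFin)
open import Data.List.Membership.Propositional using () renaming (_∈_ to _∈ₗ_)
open import Data.List.Membership.Propositional.Properties using (∈-filter⁺; ∈-filter⁻; ∈-allFin)
open import Data.List.Relation.Unary.Any using (here; there)
open import Data.Nat using (ℕ; zero; suc; _+_; _*_; _≤_; _<_; z≤n; s≤s)
open import Data.Nat.Induction using (<-rec)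
open import Data.Nat.Properties
  using (+-0-commutativeMonoid; +-assoc; +-comm; +-identityʳ; *-assoc; *-comm; *-identityʳ;
         *-distribˡ-+; *-distribʳ-+; *-cancelˡ-≤; +-cancelʳ-≤; +-mono-≤; +-monoʳ-≤; *-monoʳ-≤;
         ≤-refl; ≤-trans; ≤-reflexive; m≤m+n; m≤n+m; n<1+n; m<n⇒m<1+n; module ≤-Reasoning)
open import Data.Nat.Solver using (module +-*-Solver)
open import Data.Product using (Σ-syntax; ∃-syntax; _×_; _,_; proj₁; proj₂)
open import Data.Product.Properties using (≡-dec)
import Data.Rational as ℚ
import Data.Rational.Properties as ℚ
import Data.Rational.Unnormalised as ℚᵘ
import Data.Rational.Unnormalised.Properties as ℚᵘ
open import Data.Sum using (_⊎_; inj₁; inj₂; [_,_]′)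
import Data.Sum as Sum
open import Data.Vec using (lookup; tabulate; []; _∷_; _[_]=_)
open import Data.Vec.Properties using (lookup∘tabulate; []=⇒lookup)
open import Function using (_∘_; _⇔_; mk⇔; Equivalence; StrictlySurjective)
open import Relation.Binary.Construct.Closure.ReflexiveTransitive using (Star; ε; _◅_; _◅◅_)
import Relation.Binary.Construct.Closure.ReflexiveTransitive as Star
open import Relation.Binary.PropositionalEquality
  using (_≡_; _≢_; refl; sym; trans; cong; cong₂; subst; subst₂; module ≡-Reasoning)
open import Relation.Nullary using (¬_; Dec; yes; no; does; contradiction)
open import Relation.Nullary.Decidable
  using (map′; ¬?; _×-dec_; _⊎-dec_; _→-dec_; from-yes; dec-true; dec-false)

open import Algebra.Properties.CommutativeMonoid.Sum +-0-commutativeMonoid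
  using (sum; sum-cong-≗; ∑-distrib-+; ∑-comm; sum-permute)

-- The reductions do not preserve claw-freeness. The induction therefore carries a vertex weight and
-- the weaker property that every vertex of weight below 3 still lies in a digon or a triangle.
-- Suppression keeps this property because the smaller graph, having no cut edge, has no loop.
-- Colourings are total on darts, and the graph enters only through the count of disagreements.
-- Lifting a colouring is thus a choice of colours at two or three vertices, whichever edges are
-- lost elsewhere. One splice of two vertices serves three times: for digons, for neighbours on a
-- cycle of the 2-factor, and for the two joinings in Frink's reduction. On a cycle it keeps the
-- parity of the length, so even cycles vanish and odd ones shrink to loops. The loop is the lost
-- edge, and its accumulated weight, at least 5, pays for it. Petersen's theorem is proved in the
-- stronger form that any given edge can be avoided by a perfect matching; the induction depends on
-- this.

private variable
  n n′ d d′ : ℕ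

-- Finite sums and permutations

sum-raise : ∀ (f g : Fin n → ℕ) j b → (∀ i → i ≢ j → f i ≡ g i) → f j + b ≡ g j →
            sum f + b ≡ sum g
sum-raise f g zero b same at-j = begin
  f zero + sum (f ∘ suc) + b    ≡⟨ +-assoc (f zero) _ b ⟩
  f zero + (sum (f ∘ suc) + b)  ≡⟨ cong (f zero +_) (+-comm _ b) ⟩
  f zero + (b + sum (f ∘ suc))  ≡⟨ +-assoc (f zero) b _ ⟨
  f zero + b + sum (f ∘ suc)    ≡⟨ cong₂ _+_ at-j (sum-cong-≗ (λ i → same (suc i) λ ())) ⟩
  g zero + sum (g ∘ suc)        ∎
  where open ≡-Reasoning
sum-raise f g (suc j) b same at-j =
  trans (+-assoc (f zero) _ b)
    (cong₂ _+_ (same zero λ ())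
      (sum-raise (f ∘ suc) (g ∘ suc) j b (λ i i≢j → same (suc i) (i≢j ∘ suc-injective)) at-j))

perm-inj : ∀ (π : Permutation n n) {i j} → π ⟨$⟩ʳ i ≡ π ⟨$⟩ʳ j → i ≡ j
perm-inj π {i} {j} eq = trans (sym (inverseˡ π)) (trans (cong (π ⟨$⟩ˡ_) eq) (inverseˡ π))

abstract
  -- These permutations bring given vertices or ports to the front. Every local argument is carried
  -- out at the vertices 0, 1, 2 and transported from there.
  perm₁ : (u : Fin (suc n)) → Σ[ π ∈ Permutation (suc n) (suc n) ] π ⟨$⟩ʳ zero ≡ u
  perm₁ u = Perm.insert zero u Perm.id , refl

  perm₂ : {u v : Fin (2 + n)} → u ≢ v →
          Σ[ π ∈ Permutation (2 + n) (2 + n) ] (π ⟨$⟩ʳ zero ≡ u × π ⟨$⟩ʳ suc zero ≡ v)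
  perm₂ {u = u} u≢v with perm₁ (punchOut u≢v)
  ... | π , π0 = Perm.insert zero u π , refl ,
    trans (cong (punchIn u) π0) (punchIn-punchOut u≢v)

  perm₃ : {u v w : Fin (3 + n)} → u ≢ v → u ≢ w → v ≢ w →
          Σ[ π ∈ Permutation (3 + n) (3 + n) ] (π ⟨$⟩ʳ zero ≡ u × π ⟨$⟩ʳ suc zero ≡ v × π ⟨$⟩ʳ suc (suc zero) ≡ w)
  perm₃ {u = u} {v} {w} u≢v u≢w v≢w
    with perm₂ {u = punchOut u≢v} {punchOut u≢w} (v≢w ∘ punchOut-injective u≢v u≢w)
  ... | π , π0 , π1 = Perm.insert zero u π , refl ,
    trans (cong (punchIn u) π0) (punchIn-punchOut u≢v) ,
    trans (cong (punchIn u) π1) (punchIn-punchOut u≢w)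

-- Dart graphs

Dart : ℕ → ℕ → Set
Dart n d = Fin n × Fin d

_≟ᴰ_ : (x y : Dart n d) → Dec (x ≡ y)
_≟ᴰ_ = ≡-dec _≟_ _≟_

vertex : Dart n d → Fin n
vertex = proj₁

port : Dart n d → Fin d
port = proj₂

sumᴰ : (Dart n d → ℕ) → ℕ
sumᴰ f = sum λ v → sum λ k → f (v , k)

sumᴰ-cong : {f g : Dart n d → ℕ} → (∀ x → f x ≡ g x) → sumᴰ f ≡ sumᴰ g
sumᴰ-cong f≗g = sum-cong-≗ λ v → sum-cong-≗ λ k → f≗g (v , k)

sumᴰ-raise : ∀ (f g : Dart n d → ℕ) y b → (∀ x → x ≢ y → f x ≡ g x) → f y + b ≡ g y →
             sumᴰ f + b ≡ sumᴰ g
sumᴰ-raise f g (v , k) b same at-j =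
  sum-raise _ _ v b
    (λ u u≢v → sum-cong-≗ λ l → same (u , l) (u≢v ∘ cong proj₁))
    (sum-raise _ _ k b (λ l l≢k → same (v , l) (l≢k ∘ cong proj₂)) at-j)

-- The d darts at each vertex are matched into the edges of a d-regular multigraph, loops allowed.
record DartGraph (n d : ℕ) : Set where
  field
    mate            : Dart n d → Dart n d
    mate-involutive : ∀ x → mate (mate x) ≡ x
    mate-irrefl     : ∀ x → mate x ≢ x

  mate-swap : ∀ {x y} → mate x ≡ y → mate y ≡ x
  mate-swap refl = mate-involutive _

  mate-injective : ∀ {x y} → mate x ≡ mate y → x ≡ y
  mate-injective eq = trans (sym (mate-swap eq)) (mate-involutive _)

open DartGraph

-- A colouring does not mention `mate`: it is admissible for every graph on the same darts. With as
-- many colours as ports, each colour occurs exactly once at each vertex.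
record Colouring (n d : ℕ) : Set where
  field
    colour : Dart n d → Fin d
    proper : ∀ {v k l} → colour (v , k) ≡ colour (v , l) → k ≡ l

open Colouring

differ : Fin d → Fin d → ℕ
differ i j = if does (i ≟ j) then 0 else 1

differ-refl : ∀ (i : Fin d) → differ i i ≡ 0
differ-refl i with i ≟ i
... | yes _  = refl
... | no i≢i = contradiction refl i≢i

differ-sym : ∀ (i j : Fin d) → differ i j ≡ differ j i
differ-sym i j with i ≟ j | j ≟ i
... | yes _    | yes _   = refl
... | no _     | no _    = refl
... | yes refl | no i≢i  = contradiction refl i≢i
... | no i≢j   | yes j≡i = contradiction (sym j≡i) i≢j

conflict : DartGraph n d → Colouring n d → Dart n d → ℕ
conflict G c x = differ (colour c x) (colour c (mate G x))

conflicts : DartGraph n d → Colouring n d → ℕ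
conflicts G c = sumᴰ (conflict G c)

-- The vehicle of "without loss of generality": vertices are permuted, and independently the ports
-- at each vertex.
record Relabelling (n d : ℕ) : Set where
  field
    π : Permutation n n
    ρ : Fin n → Permutation d d

  to : Dart n d → Dart n d
  to (v , k) = π ⟨$⟩ʳ v , ρ v ⟨$⟩ʳ k

  from : Dart n d → Dart n d
  from (w , j) = π ⟨$⟩ˡ w , ρ (π ⟨$⟩ˡ w) ⟨$⟩ˡ j

  to-from : ∀ x → to (from x) ≡ x
  to-from (w , j) = cong₂ _,_ (inverseʳ π) (inverseʳ (ρ (π ⟨$⟩ˡ w)))

  from-to : ∀ x → from (to x) ≡ x
  from-to (v , k) rewrite inverseˡ π {v} = cong (v ,_) (inverseˡ (ρ v))

open Relabelling

relabel : DartGraph n d → Relabelling n d → DartGraph n d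
mate            (relabel G R) x = from R (mate G (to R x))
mate-involutive (relabel G R) x =
  trans (cong (from R ∘ mate G) (to-from R _))
    (trans (cong (from R) (mate-involutive G _)) (from-to R x))
mate-irrefl     (relabel G R) x eq =
  mate-irrefl G (to R x) (trans (sym (to-from R _)) (cong (to R) eq))

to-mate : ∀ (G : DartGraph n d) R x → to R (mate (relabel G R) x) ≡ mate G (to R x)
to-mate G R x = to-from R _

relabel-mate : ∀ (G : DartGraph n d) R {x y} → mate G (to R x) ≡ to R y → mate (relabel G R) x ≡ y
relabel-mate G R eq = trans (cong (from R) eq) (from-to R _)

sumᴰ-relabel : ∀ (R : Relabelling n d) f → sumᴰ f ≡ sumᴰ (f ∘ to R)
sumᴰ-relabel R f = trans (sum-permute _ (π R))
  (sum-cong-≗ λ v → sum-permute _ (ρ R v))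

colouring-relabel : ∀ (G : DartGraph n d) R (c : Colouring n d) →
                    ∃[ c′ ] conflicts G c′ ≡ conflicts (relabel G R) c
colouring-relabel G R c = c′ ,
  trans (sumᴰ-relabel R _) (sumᴰ-cong λ x → cong (λ i → differ i (colour c (from R (mate G (to R x))))) (pull x))
  where
  c′ : Colouring _ _
  colour c′ x = colour c (from R x)
  proper c′ {v} eq = perm-inj (Perm.flip (ρ R (π R ⟨$⟩ˡ v))) (proper c eq)

  pull : ∀ x → colour c′ (to R x) ≡ colour c x
  pull x = cong (colour c) (from-to R x)

-- Cuts with a single edge

Crosses : DartGraph n d → (Fin n → Bool) → Dart n d → Set
Crosses G S x = S (vertex x) ≢ S (vertex (mate G x))

-- A bridge, described without paths or components as the only edge leaving some vertex set. In this
-- form it passes between graphs by extending or pulling back `S`.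
record CutEdge (G : DartGraph n d) (S : Fin n → Bool) (x : Dart n d) : Set where
  field
    crosses : Crosses G S x
    only    : ∀ y → Crosses G S y → y ≡ x ⊎ y ≡ mate G x

open CutEdge

NoCutEdge : DartGraph n d → Set
NoCutEdge G = ∀ S x → ¬ CutEdge G S x

-- A dart that crosses in `G` has a partner that crosses in `G′`, so the partner lies on the only
-- crossing edge there. The relation respects mates, and a dart of `G′` has at most one partner, so
-- the original dart is `x` or its mate.
cutEdge-transfer :
  ∀ (G : DartGraph n d) (G′ : DartGraph n′ d′) {S S′} (_~_ : Dart n d → Dart n′ d′ → Set) →
  (∀ {y z} → y ~ z → mate G y ~ mate G′ z) →
  (∀ {y y′ z} → y ~ z → y′ ~ z → y ≡ y′) →
  (∀ y → Crosses G S y → ∃[ z ] (y ~ z × Crosses G′ S′ z)) →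
  ∀ {x z} → x ~ z → Crosses G S x → CutEdge G′ S′ z → CutEdge G S x
crosses (cutEdge-transfer G G′ _~_ step inj image x~z crx ce) = crx
only    (cutEdge-transfer G G′ _~_ step inj image x~z crx ce) y cry with image y cry
... | w , y~w , crw with only ce w crw
... | inj₁ refl = inj₁ (inj y~w x~z)
... | inj₂ refl = inj₂ (inj y~w (step x~z))

noCutEdge-relabel : ∀ (G : DartGraph n d) R → NoCutEdge G → NoCutEdge (relabel G R)
noCutEdge-relabel G R nce S x ce = nce (S ∘ (π R ⟨$⟩ˡ_)) (to R x)
  (cutEdge-transfer G (relabel G R) (λ y z → y ≡ to R z)
    (λ { {z = z} refl → sym (to-mate G R z) })
    (λ eq eq′ → trans eq (sym eq′))
    (λ y cr → from R y , sym (to-from R y) ,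
      λ eq → cr (trans eq (cong (S ∘ vertex ∘ from R ∘ mate G) (to-from R y))))
    refl
    (λ eq → crosses ce (trans (sym (cong S (inverseˡ (π R)))) eq))
    ce)

third : ∀ (k l : Fin 3) → k ≢ l → ∃[ m ] (m ≢ k × m ≢ l × ∀ j → j ≢ k → j ≢ l → j ≡ m)
third = from-yes (all? {n = 3} λ k → all? {n = 3} λ l → ¬? (k ≟ l) →-dec any? {n = 3} λ m →
  ¬? (m ≟ k) ×-dec ¬? (m ≟ l) ×-dec all? {n = 3} λ j → ¬? (j ≟ k) →-dec (¬? (j ≟ l) →-dec (j ≟ m)))

is : Fin n → Fin n → Bool
is v u = does (u ≟ v)

-- The third edge at a vertex with a loop is a cut edge.
no-loop : ∀ (G : DartGraph n 3) → NoCutEdge G → ∀ x → vertex (mate G x) ≢ vertex x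
no-loop G nce (v , k) loop with mate G (v , k) in eq
no-loop G nce (v , k) refl | .v , l with third k l (λ { refl → mate-irrefl G (v , k) eq })
... | m , m≢k , m≢l , only-m = nce (is v) (v , m) record
  { crosses = λ eq′ → out (sym (is-injective (trans (sym (dec-true (v ≟ v) refl)) eq′)))
  ; only    = only′
  }
  where
  is-injective : ∀ {u} → true ≡ is v u → v ≡ u
  is-injective {u} eq′ with u ≟ v
  ... | yes u≡v = sym u≡v

  out : vertex (mate G (v , m)) ≢ v
  out stays with mate G (v , m) in eqm
  out refl | .v , j with j ≟ k | j ≟ l
  ... | yes refl | _        = m≢l (cong port (mate-injective G (trans eqm (sym (mate-swap G eq)))))
  ... | no _     | yes refl = m≢k (cong port (mate-injective G (trans eqm (sym eq))))
  ... | no j≢k   | no j≢l   = mate-irrefl G (v , m) (trans eqm (cong (v ,_) (only-m j j≢k j≢l)))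

  exit : ∀ {y} → vertex y ≡ v → vertex (mate G y) ≢ v → y ≡ (v , m)
  exit {.v , j} refl away = cong (v ,_) (only-m j
    (λ { refl → away (cong vertex eq) })
    (λ { refl → away (cong vertex (mate-swap G eq)) }))

  only′ : ∀ y → Crosses G (is v) y → y ≡ (v , m) ⊎ y ≡ mate G (v , m)
  only′ y cr with vertex y ≟ v | vertex (mate G y) ≟ v
  ... | yes p | yes q = contradiction refl cr
  ... | no _  | no _  = contradiction refl cr
  ... | yes p | no q  = inj₁ (exit p q)
  ... | no p  | yes q = inj₂ (trans (sym (mate-involutive G y))
    (cong (mate G) (exit q (λ r → p (trans (cong vertex (sym (mate-involutive G y))) r)))))

-- Splicing two vertices

keep : Dart n d → Dart (2 + n) d
keep (v , k) = suc (suc v) , k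

keep-injective : ∀ {x y : Dart n d} → keep x ≡ keep y → x ≡ y
keep-injective refl = refl

-- If every port is of one of these two kinds, a glued edge passes through the removed vertices only
-- once. A dart such as `(zero , k)` mated to `(suc zero , j)` with `j` different from `k` would
-- continue the gluing along a chain.
Inner Outer : DartGraph (2 + n) d → Fin d → Set
Inner G k = mate G (zero , k) ≡ (suc zero , k)
Outer G k = (∃[ a ] mate G (zero , k) ≡ keep a) × (∃[ b ] mate G (suc zero , k) ≡ keep b)

-- Vertices 0 and 1 are removed, and the darts (0, k) and (1, k) are glued for each k.
module _ (G : DartGraph (2 + n) d) (rungs : ∀ k → Inner G k ⊎ Outer G k) where

  -- The new mate is first given as a relation. Its symmetry, irreflexivity and functionality are
  -- read off the constructors and yield the laws of `mate` for `splice`.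
  data Link (x y : Dart n d) : Set where
    direct : mate G (keep x) ≡ keep y → Link x y
    via₀   : ∀ k → mate G (zero , k) ≡ keep x → mate G (suc zero , k) ≡ keep y → Link x y
    via₁   : ∀ k → mate G (suc zero , k) ≡ keep x → mate G (zero , k) ≡ keep y → Link x y

  link : ∀ x → ∃[ y ] Link x y
  link x with mate G (keep x) in eq
  ... | suc (suc v) , k = (v , k) , direct eq
  ... | zero , k with rungs k
  ...   | inj₁ inner with () ← trans (sym inner) (mate-swap G eq)
  ...   | inj₂ (_ , b , outer) = b , via₀ k (mate-swap G eq) outer
  link x | suc zero , k with rungs k
  ...   | inj₁ inner with () ← trans (sym (mate-swap G inner)) (mate-swap G eq)
  ...   | inj₂ ((a , outer) , _) = a , via₁ k (mate-swap G eq) outer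

  link-sym : ∀ {x y} → Link x y → Link y x
  link-sym (direct p)   = direct (mate-swap G p)
  link-sym (via₀ k p q) = via₁ k q p
  link-sym (via₁ k p q) = via₀ k q p

  link-irrefl : ∀ {x} → ¬ Link x x
  link-irrefl (direct p) = mate-irrefl G _ p
  link-irrefl (via₀ k p q) with () ← mate-injective G (trans p (sym q))
  link-irrefl (via₁ k p q) with () ← mate-injective G (trans p (sym q))

  link-functional : ∀ {x y z} → Link x y → Link x z → y ≡ z
  link-functional (direct p) (direct q) = keep-injective (trans (sym p) q)
  link-functional (direct p) (via₀ k q _) with () ← trans (sym (mate-swap G q)) p
  link-functional (direct p) (via₁ k q _) with () ← trans (sym (mate-swap G q)) p
  link-functional (via₀ k p _) (direct q) with () ← trans (sym (mate-swap G p)) q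
  link-functional (via₁ k p _) (direct q) with () ← trans (sym (mate-swap G p)) q
  link-functional (via₀ k p p′) (via₀ l q q′) with refl ← mate-injective G (trans p (sym q)) =
    keep-injective (trans (sym p′) q′)
  link-functional (via₁ k p p′) (via₁ l q q′) with refl ← mate-injective G (trans p (sym q)) =
    keep-injective (trans (sym p′) q′)
  link-functional (via₀ k p _) (via₁ l q _) with () ← mate-injective G (trans p (sym q))
  link-functional (via₁ k p _) (via₀ l q _) with () ← mate-injective G (trans p (sym q))

  abstract
    splice : DartGraph n d
    mate            splice x = proj₁ (link x)
    mate-involutive splice x =
      link-functional (proj₂ (link (proj₁ (link x)))) (link-sym (proj₂ (link x)))
    mate-irrefl     splice x eq = link-irrefl (subst (Link x) eq (proj₂ (link x)))

    mate-splice : ∀ {x y} → Link x y → mate splice x ≡ y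
    mate-splice {x} l = link-functional (proj₂ (link x)) l

    splice-link : ∀ x → Link x (mate splice x)
    splice-link x = proj₂ (link x)

-- With a single outer pair, the splice suppresses the vertices 0 and 1 inside an edge.
rungs₁ : ∀ (G : DartGraph (2 + n) d) o → (∀ k → k ≢ o → Inner G k) → ∀ k → Inner G k ⊎ Outer G k
rungs₁ G o inner k with k ≟ o
... | no k≢o = inj₁ (inner k k≢o)
... | yes refl with mate G (zero , k) in eq
...   | zero , j with j ≟ k
...     | yes refl = contradiction eq (mate-irrefl G _)
...     | no j≢k with () ← trans (sym (inner j j≢k)) (mate-swap G eq)
rungs₁ G o inner k | yes refl | suc zero , j with j ≟ k
...     | yes refl = inj₁ refl
...     | no j≢k with refl ← trans (sym (mate-swap G (inner j j≢k))) (mate-swap G eq) = contradiction refl j≢k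
rungs₁ G o inner k | yes refl | suc (suc v) , j with mate G (suc zero , k) in eq′
...     | suc (suc w) , l = inj₂ ((_ , refl) , _ , refl)
...     | zero , l with l ≟ k
...       | yes refl with () ← trans (sym eq) (mate-swap G eq′)
...       | no l≢k with refl ← trans (sym (inner l l≢k)) (mate-swap G eq′) = contradiction refl l≢k
rungs₁ G o inner k | yes refl | suc (suc v) , j | suc zero , l with l ≟ k
...       | yes refl = contradiction eq′ (mate-irrefl G _)
...       | no l≢k with () ← trans (sym (mate-swap G (inner l l≢k))) (mate-swap G eq′)

extend : Bool → Bool → (Fin n → Bool) → Fin (2 + n) → Bool
extend s₀ s₁ S zero          = s₀
extend s₀ s₁ S (suc zero)    = s₁
extend s₀ s₁ S (suc (suc v)) = S v

module _ (G : DartGraph (2 + n) d) (o : Fin d) (inner : ∀ k → k ≢ o → Inner G k) where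

  suppress : DartGraph n d
  suppress = splice G (rungs₁ G o inner)

  outer-port : ∀ {k j} {x : Dart n d} → mate G (j , k) ≡ keep x → j ≡ zero ⊎ j ≡ suc zero → k ≡ o
  outer-port {k} p at with k ≟ o
  ... | yes k≡o = k≡o
  outer-port {k} p (inj₁ refl) | no k≢o with () ← trans (sym p) (inner k k≢o)
  outer-port {k} p (inj₂ refl) | no k≢o with () ← trans (sym p) (mate-swap G (inner k k≢o))

  suppress-inner : Inner G o → ∀ x → mate G (keep x) ≡ keep (mate suppress x)
  suppress-inner inn x with splice-link G (rungs₁ G o inner) x
  ... | direct p = p
  ... | via₀ k p _ with refl ← outer-port p (inj₁ refl) with () ← trans (sym p) inn
  ... | via₁ k p q with refl ← outer-port q (inj₁ refl) with () ← trans (sym q) inn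

  module _ {a b} (ma : mate G (zero , o) ≡ keep a) (mb : mate G (suc zero , o) ≡ keep b) where

    suppress-a : mate suppress a ≡ b
    suppress-a = mate-splice G (rungs₁ G o inner) (via₀ o ma mb)

    suppress-link : ∀ x → mate G (keep x) ≡ keep (mate suppress x) ⊎ x ≡ a ⊎ x ≡ b
    suppress-link x with splice-link G (rungs₁ G o inner) x
    ... | direct p = inj₁ p
    ... | via₀ k p q with refl ← outer-port p (inj₁ refl) = inj₂ (inj₁ (keep-injective (trans (sym p) ma)))
    ... | via₁ k p q with refl ← outer-port q (inj₁ refl) = inj₂ (inj₂ (keep-injective (trans (sym p) mb)))

sum-zero : ∀ (f : Fin n → ℕ) → (∀ i → f i ≡ 0) → sum f ≡ 0
sum-zero {zero}  f z = refl
sum-zero {suc n} f z = cong₂ _+_ (z zero) (sum-zero (f ∘ suc) (z ∘ suc))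

sum-single : ∀ (f : Fin n → ℕ) j → (∀ i → i ≢ j → f i ≡ 0) → sum f ≡ f j
sum-single {n} f j z = trans
  (sym (sum-raise (λ _ → 0) f j (f j) (λ i i≢j → sym (z i i≢j)) refl))
  (cong (_+ f j) (sum-zero {n} _ (λ _ → refl)))

transpose-at : ∀ (i j : Fin n) → transpose i j ⟨$⟩ʳ i ≡ j
transpose-at i j rewrite dec-true (i ≟ i) refl = refl

module _ (G : DartGraph (2 + n) d) (o : Fin d) (inner : ∀ k → k ≢ o → Inner G k) where

  private
    G′ = suppress G o inner

  -- The removed vertices are put on the side of `a`. Of the edges at 0 and 1, only the one between
  -- 1 and `b` can then cross, and it does so exactly when the new edge does. If `o` is inner too,
  -- no edge joins 0 and 1 to the rest, and any common side will do.
  noCutEdge-suppress : NoCutEdge G → NoCutEdge G′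
  noCutEdge-suppress nce S x ce with rungs₁ G o inner o
  ... | inj₁ inn = nce (extend true true S) (keep x)
    (cutEdge-transfer G G′ (λ y z → y ≡ keep z)
      (λ { {z = z} refl → suppress-inner G o inner inn z })
      (λ p q → trans p (sym q))
      image refl
      (λ eq → crosses ce (trans eq (cong (extend true true S ∘ vertex) (suppress-inner G o inner inn x))))
      ce)
    where
    ext = extend true true S

    rung : ∀ k → Inner G k
    rung k with k ≟ o
    ... | yes refl = inn
    ... | no k≢o   = inner k k≢o

    image : ∀ y → Crosses G ext y → ∃[ z ] (y ≡ keep z × Crosses G′ S z)
    image (zero , k)        cr = contradiction (cong (ext ∘ vertex) (sym (rung k))) cr
    image (suc zero , k)    cr = contradiction (cong (ext ∘ vertex) (sym (mate-swap G (rung k)))) cr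
    image (suc (suc v) , k) cr = (v , k) , refl , λ eq →
      cr (trans eq (cong (ext ∘ vertex) (sym (suppress-inner G o inner inn (v , k)))))
  ... | inj₂ ((a , ma) , b , mb) = descend (suppress-link G o inner ma mb x)
    where
    ext = extend (S (vertex a)) (S (vertex a)) S

    -- The edge between 1 and `b` takes over the role of the new edge, so the partner of `a` is the
    -- dart at 1 and not `keep a`.
    data _~_ : Dart (2 + n) d → Dart n d → Set where
      kept : ∀ {z w} → mate G (keep z) ≡ keep w → keep z ~ z
      far  : (suc zero , o) ~ a
      near : keep b ~ b

    step : ∀ {y z} → y ~ z → mate G y ~ mate G′ z
    step (kept p) = subst₂ _~_ (sym p) (sym (mate-splice G (rungs₁ G o inner) (direct p)))
      (kept (mate-swap G p))
    step far      = subst₂ _~_ (sym mb) (sym (suppress-a G o inner ma mb)) near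
    step near     = subst₂ _~_ (sym (mate-swap G mb)) (sym (mate-swap G′ (suppress-a G o inner ma mb))) far

    injective : ∀ {y y′ z} → y ~ z → y′ ~ z → y ≡ y′
    injective (kept p) (kept q) = refl
    injective (kept p) far with () ← trans (sym p) (mate-swap G ma)
    injective (kept p) near = refl
    injective far (kept p) with () ← trans (sym p) (mate-swap G ma)
    injective far far = refl
    injective far near with () ← mate-injective G (trans ma (sym mb))
    injective near (kept p) = refl
    injective near far with () ← mate-injective G (trans ma (sym mb))
    injective near near = refl

    crosses-direct : ∀ {z w} → mate G (keep z) ≡ keep w → Crosses G ext (keep z) → Crosses G′ S z
    crosses-direct p cr eq = cr (trans eq (trans
      (cong (S ∘ vertex) (mate-splice G (rungs₁ G o inner) (direct p))) (cong (ext ∘ vertex) (sym p))))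

    image : ∀ y → Crosses G ext y → ∃[ z ] (y ~ z × Crosses G′ S z)
    image (zero , k) cr with k ≟ o
    ... | yes refl = contradiction (cong (ext ∘ vertex) (sym ma)) cr
    ... | no k≢o   = contradiction (cong (ext ∘ vertex) (sym (inner k k≢o))) cr
    image (suc zero , k) cr with k ≟ o
    ... | yes refl = a , far , λ eq → cr (trans eq (trans
      (cong (S ∘ vertex) (suppress-a G o inner ma mb)) (cong (ext ∘ vertex) (sym mb))))
    ... | no k≢o   = contradiction (cong (ext ∘ vertex) (sym (mate-swap G (inner k k≢o)))) cr
    image (suc (suc v) , k) cr with suppress-link G o inner ma mb (v , k)
    ... | inj₁ p = (v , k) , kept p , crosses-direct p cr
    ... | inj₂ (inj₁ refl) = contradiction (cong (ext ∘ vertex) (sym (mate-swap G ma))) cr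
    ... | inj₂ (inj₂ refl) = b , near , λ eq → cr (trans eq (trans
      (cong (S ∘ vertex) (mate-swap G′ (suppress-a G o inner ma mb)))
      (cong (ext ∘ vertex) (sym (mate-swap G mb)))))

    descend : mate G (keep x) ≡ keep (mate G′ x) ⊎ x ≡ a ⊎ x ≡ b → _
    descend (inj₁ p) = nce ext (keep x)
      (cutEdge-transfer G G′ _~_ step injective image (kept p)
        (λ eq → crosses ce (trans eq (cong (ext ∘ vertex) p))) ce)
    descend (inj₂ (inj₁ refl)) = nce ext (suc zero , o)
      (cutEdge-transfer G G′ _~_ step injective image far
        (λ eq → crosses ce (trans eq (trans (cong (ext ∘ vertex) mb)
          (cong (S ∘ vertex) (sym (suppress-a G o inner ma mb)))))) ce)
    descend (inj₂ (inj₂ refl)) = nce ext (keep b)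
      (cutEdge-transfer G G′ _~_ step injective image near
        (λ eq → crosses ce (trans eq (trans (cong (ext ∘ vertex) (mate-swap G mb))
          (cong (S ∘ vertex) (sym (mate-swap G′ (suppress-a G o inner ma mb))))))) ce)

  -- The dart (1, o) gets the colour of the dart it is glued to, so that a conflict of the
  -- new edge reappears at (0, o) only.
  module _ (c : Colouring n d) (σ : Permutation d d) where

    unsuppress : Colouring (2 + n) d
    colour unsuppress (zero , k)        = σ ⟨$⟩ʳ k
    colour unsuppress (suc zero , k)    = σ ⟨$⟩ʳ k
    colour unsuppress (suc (suc v) , k) = colour c (v , k)
    proper unsuppress {zero}        eq = perm-inj σ eq
    proper unsuppress {suc zero}    eq = perm-inj σ eq
    proper unsuppress {suc (suc v)} eq = proper c eq

    conflict-direct : ∀ x → mate G (keep x) ≡ keep (mate G′ x) →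
                      conflict G unsuppress (keep x) ≡ conflict G′ c x
    conflict-direct x p rewrite p = refl

    conflict₀ : ∀ k → Inner G k → conflict G unsuppress (zero , k) ≡ 0
    conflict₀ k p rewrite p = differ-refl (σ ⟨$⟩ʳ k)

    conflict₁ : ∀ k → Inner G k → conflict G unsuppress (suc zero , k) ≡ 0
    conflict₁ k p rewrite mate-swap G p = differ-refl (σ ⟨$⟩ʳ k)

  colouring-suppress : ∀ c → ∃[ c′ ] conflicts G c′ ≡ conflicts G′ c
  colouring-suppress c with rungs₁ G o inner o
  ... | inj₁ inn = unsuppress c Perm.id ,
    trans (cong₂ _+_ (sum-zero {d} _ λ k → conflict₀ c Perm.id k (rung k))
          (cong₂ _+_ (sum-zero {d} _ λ k → conflict₁ c Perm.id k (rung k)) refl))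
      (sumᴰ-cong λ x → conflict-direct c Perm.id x (suppress-inner G o inner inn x))
    where
    rung : ∀ k → Inner G k
    rung k with k ≟ o
    ... | yes refl = inn
    ... | no k≢o   = inner k k≢o
  ... | inj₂ ((a , ma) , b , mb) = c′ , (begin
    sum (λ k → f (zero , k)) + (sum (λ k → f (suc zero , k)) + sumᴰ (f ∘ keep))
      ≡⟨ cong₂ _+_ (trans (sum-single _ o (λ k k≢o → conflict₀ c σ k (inner k k≢o))) f₀)
                   (cong (_+ sumᴰ (f ∘ keep)) (sum-zero {d} _ f₁)) ⟩
    δ + sumᴰ (f ∘ keep)  ≡⟨ +-comm δ _ ⟩
    sumᴰ (f ∘ keep) + δ  ≡⟨ sumᴰ-raise (f ∘ keep) (conflict G′ c) b δ same (cong₂ _+_ fb δ≡) ⟩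
    conflicts G′ c       ∎)
    where
    open ≡-Reasoning
    -- What matters is that `σ` sends `o` to the colour at `b`. The inner edges agree because 0 and
    -- 1 use the same `σ`.
    σ  = transpose o (colour c b)
    c′ = unsuppress c σ
    f  = conflict G c′
    δ  = differ (colour c b) (colour c a)

    a↔b : mate G′ a ≡ b
    a↔b = suppress-a G o inner ma mb

    δ≡ : δ ≡ conflict G′ c b
    δ≡ = cong (differ (colour c b) ∘ colour c) (sym (mate-swap G′ a↔b))

    f₀ : f (zero , o) ≡ δ
    f₀ rewrite ma = cong (λ i → differ i (colour c a)) (transpose-at o (colour c b))

    f₁ : ∀ k → f (suc zero , k) ≡ 0
    f₁ k = by (k ≟ o)
      where
      by : Dec (k ≡ o) → f (suc zero , k) ≡ 0
      by (no k≢o)   = conflict₁ c σ k (inner k k≢o)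
      by (yes refl) = trans (cong (differ (σ ⟨$⟩ʳ o) ∘ colour c′) mb)
        (trans (cong (λ i → differ i (colour c b)) (transpose-at o (colour c b))) (differ-refl (colour c b)))

    fb : f (keep b) ≡ 0
    fb rewrite mate-swap G mb =
      trans (cong (differ (colour c b)) (transpose-at o (colour c b))) (differ-refl (colour c b))

    same : ∀ x → x ≢ b → f (keep x) ≡ conflict G′ c x
    same x x≢b with suppress-link G o inner ma mb x
    ... | inj₁ p           = conflict-direct c σ x p
    ... | inj₂ (inj₂ refl) = contradiction refl x≢b
    ... | inj₂ (inj₁ refl) rewrite mate-swap G ma | a↔b =
      cong (differ (colour c a)) (transpose-at o (colour c b))

abstract
  relabelling₂ : {u v : Fin (2 + n)} → u ≢ v → (ρ₀ ρ₁ : Permutation d d) →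
    Σ[ R ∈ Relabelling (2 + n) d ] ((∀ k → to R (zero , k) ≡ (u , ρ₀ ⟨$⟩ʳ k)) ×
                                 (∀ k → to R (suc zero , k) ≡ (v , ρ₁ ⟨$⟩ʳ k)))
  relabelling₂ {n = n} {d = d} u≢v ρ₀ ρ₁ with perm₂ u≢v
  ... | π , π0 , π1 = record { π = π ; ρ = ports } , (λ k → cong (_, _) π0) , (λ k → cong (_, _) π1)
    where
    ports : Fin (2 + n) → Permutation d d
    ports zero          = ρ₀
    ports (suc zero)    = ρ₁
    ports (suc (suc _)) = Perm.id

-- 2-regular graphs

record Triangle (G : DartGraph n d) (x y z : Dart n d) : Set where
  field
    xy : vertex y ≡ vertex (mate G x)
    yz : vertex z ≡ vertex (mate G y)
    zx : vertex x ≡ vertex (mate G z)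

open Triangle

vertex-relabel : ∀ (G : DartGraph n d) R x → vertex (mate G (to R x)) ≡ π R ⟨$⟩ʳ vertex (mate (relabel G R) x)
vertex-relabel G R x = cong vertex (sym (to-mate G R x))

triangle-relabel : ∀ (G : DartGraph n d) R {x y z} → Triangle (relabel G R) x y z →
                   Triangle G (to R x) (to R y) (to R z)
xy (triangle-relabel G R {x = x} t) = trans (cong (π R ⟨$⟩ʳ_) (xy t)) (sym (vertex-relabel G R x))
yz (triangle-relabel G R {y = y} t) = trans (cong (π R ⟨$⟩ʳ_) (yz t)) (sym (vertex-relabel G R y))
zx (triangle-relabel G R {z = z} t) = trans (cong (π R ⟨$⟩ʳ_) (zx t)) (sym (vertex-relabel G R z))

-- The weights count the vertices of the initial graph that were merged into a vertex.  A loop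
-- is only assumed to be heavy, but closed walks of length 3 that traverse a loop then are as well.
record LongCycles (G : DartGraph n d) (w : Fin n → ℕ) : Set where
  field
    positive : ∀ v → 1 ≤ w v
    loop     : ∀ x → vertex (mate G x) ≡ vertex x → 5 ≤ w (vertex x)
    triangle : ∀ x y z → Triangle G x y z → 5 ≤ w (vertex x) + w (vertex y) + w (vertex z)

open LongCycles

longCycles-relabel : ∀ (G : DartGraph n d) R {w} → LongCycles G w →
                     LongCycles (relabel G R) (w ∘ (π R ⟨$⟩ʳ_))
positive (longCycles-relabel G R lc) v         = positive lc _
loop     (longCycles-relabel G R lc) x l       = loop lc (to R x) (trans (vertex-relabel G R x) (cong (π R ⟨$⟩ʳ_) l))
triangle (longCycles-relabel G R lc) x y z t   = triangle lc _ _ _ (triangle-relabel G R t)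

module _ (G : DartGraph (2 + n) 2) (inner : Inner G zero) where

  private
    inner′ : ∀ k → k ≢ suc zero → Inner G k
    inner′ zero       _   = inner
    inner′ (suc zero) 1≢1 = contradiction refl 1≢1

    G′ = suppress G (suc zero) inner′

  -- The weight of 0 and 1 moves to the vertex of `a`, which then weighs at least 3, so a triangle
  -- through it weighs at least 3 + 1 + 1. A triangle that avoids this vertex avoids the new edge
  -- and is an old one. If 0 and 1 form a cycle of length two, it costs nothing, and its weight is
  -- discarded; hence the inequality.
  longCycles-suppress :
    ∀ w → LongCycles G w → ∃[ w′ ] (LongCycles G′ w′ × sum w′ ≤ sum w)
  longCycles-suppress w lc with rungs₁ G (suc zero) inner′ (suc zero)
  ... | inj₁ inn = (λ v → w (suc (suc v))) , lc′ , ≤-trans (m≤n+m _ (w (suc zero))) (m≤n+m _ (w zero))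
    where
    kept : ∀ x → vertex (mate G (keep x)) ≡ suc (suc (vertex (mate G′ x)))
    kept x = cong vertex (suppress-inner G (suc zero) inner′ inn x)

    lc′ : LongCycles G′ (λ v → w (suc (suc v)))
    positive lc′ v = positive lc _
    loop     lc′ x l = loop lc (keep x) (trans (kept x) (cong (λ v → suc (suc v)) l))
    triangle lc′ x y z t = triangle lc (keep x) (keep y) (keep z) record
      { xy = trans (cong (λ v → suc (suc v)) (xy t)) (sym (kept x))
      ; yz = trans (cong (λ v → suc (suc v)) (yz t)) (sym (kept y))
      ; zx = trans (cong (λ v → suc (suc v)) (zx t)) (sym (kept z))
      }
  ... | inj₂ ((a , ma) , b , mb) = w′ , lc′ , ≤-reflexive total
    where
    m : ℕ
    m = w zero + w (suc zero)

    w′ : Fin n → ℕ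
    w′ v = w (suc (suc v)) + (if does (v ≟ vertex a) then m else 0)

    w′-a : w′ (vertex a) ≡ w (suc (suc (vertex a))) + m
    w′-a with vertex a ≟ vertex a
    ... | yes _  = refl
    ... | no a≢a = contradiction refl a≢a

    w≤w′ : ∀ v → w (suc (suc v)) ≤ w′ v
    w≤w′ v = m≤m+n _ _

    total : sum w′ ≡ sum w
    total = trans (sym (sum-raise (λ v → w (suc (suc v))) w′ (vertex a) m same (sym w′-a)))
      (trans (+-comm _ m) (+-assoc (w zero) _ _))
      where
      same : ∀ v → v ≢ vertex a → w (suc (suc v)) ≡ w′ v
      same v v≢a with v ≟ vertex a
      ... | yes v≡a = contradiction v≡a v≢a
      ... | no _    = sym (+-identityʳ _)

    heavy : 3 ≤ w′ (vertex a)
    heavy = subst (3 ≤_) (sym w′-a)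
      (+-mono-≤ (positive lc _) (+-mono-≤ (positive lc zero) (positive lc (suc zero))))

    positive′ : ∀ v → 1 ≤ w′ v
    positive′ v = ≤-trans (positive lc _) (w≤w′ v)

    -- A loop at a after the suppression was a triangle through 0 and 1.
    loop-a : vertex a ≡ vertex b → 5 ≤ w′ (vertex a)
    loop-a a≡b = subst (5 ≤_) (trans (+-assoc (w (suc (suc (vertex a)))) _ _) (sym w′-a))
      (triangle lc (keep a) (zero , zero) (suc zero , suc zero) record
        { xy = sym (cong vertex (mate-swap G ma))
        ; yz = sym (cong vertex inner)
        ; zx = trans (cong (λ v → suc (suc v)) a≡b) (sym (cong vertex mb))
        })

    a↔b : mate G′ a ≡ b
    a↔b = suppress-a G (suc zero) inner′ ma mb

    link′ : ∀ x → mate G (keep x) ≡ keep (mate G′ x) ⊎ x ≡ a ⊎ x ≡ b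
    link′ = suppress-link G (suc zero) inner′ ma mb

    lc′ : LongCycles G′ w′
    positive lc′ = positive′
    loop     lc′ x l with link′ x
    ... | inj₁ p = ≤-trans (loop lc (keep x) (trans (cong vertex p) (cong (λ v → suc (suc v)) l))) (w≤w′ _)
    ... | inj₂ (inj₁ refl) = loop-a (trans (sym l) (cong vertex a↔b))
    ... | inj₂ (inj₂ refl) = subst (λ v → 5 ≤ w′ v) a≡b (loop-a a≡b)
      where a≡b = trans (cong vertex (sym (mate-swap G′ a↔b))) l
    triangle lc′ x y z t = by (vertex x ≟ vertex a) (vertex y ≟ vertex a) (vertex z ≟ vertex a)
      where
      step : ∀ {u} v → vertex v ≡ vertex (mate G′ u) → vertex u ≢ vertex a → vertex v ≢ vertex a →
             suc (suc (vertex v)) ≡ vertex (mate G (keep u))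
      step {u} v e u≢a v≢a with link′ u
      ... | inj₁ p = trans (cong (λ i → suc (suc i)) e) (sym (cong vertex p))
      ... | inj₂ (inj₁ refl) = contradiction refl u≢a
      ... | inj₂ (inj₂ refl) = contradiction (trans e (cong vertex (mate-swap G′ a↔b))) v≢a

      heavy-at : ∀ {v} → v ≡ vertex a → 3 ≤ w′ v
      heavy-at refl = heavy

      by : Dec (vertex x ≡ vertex a) → Dec (vertex y ≡ vertex a) → Dec (vertex z ≡ vertex a) →
           5 ≤ w′ (vertex x) + w′ (vertex y) + w′ (vertex z)
      by (yes p) _ _ = +-mono-≤ (+-mono-≤ (heavy-at p) (positive′ (vertex y))) (positive′ (vertex z))
      by (no _) (yes p) _ = +-mono-≤ (+-mono-≤ (positive′ (vertex x)) (heavy-at p)) (positive′ (vertex z))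
      by (no _) (no _) (yes p) = +-mono-≤ (+-mono-≤ (positive′ (vertex x)) (positive′ (vertex y))) (heavy-at p)
      by (no p) (no q) (no r) = ≤-trans
        (triangle lc (keep x) (keep y) (keep z) record
          { xy = step y (xy t) p q ; yz = step z (yz t) q r ; zx = step x (zx t) r p })
        (+-mono-≤ (+-mono-≤ (w≤w′ (vertex x)) (w≤w′ (vertex y))) (w≤w′ (vertex z)))

  suppressed = G′
  colouring-suppress₂ : ∀ c → ∃[ c′ ] conflicts G c′ ≡ conflicts G′ c
  colouring-suppress₂ = colouring-suppress G (suc zero) inner′

portColouring : Colouring n d
colour portColouring = port
proper portColouring eq = eq

differ≤1 : ∀ (i j : Fin d) → differ i j ≤ 1
differ≤1 i j with does (i ≟ j)
... | true  = z≤n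
... | false = s≤s z≤n

other-port : ∀ {k l : Fin 2} → k ≢ l → ∀ j → j ≡ k ⊎ j ≡ l
other-port {zero}     {zero}     k≢l _ = contradiction refl k≢l
other-port {suc zero} {suc zero} k≢l _ = contradiction refl k≢l
other-port {zero}     {suc zero} _ zero       = inj₁ refl
other-port {zero}     {suc zero} _ (suc zero) = inj₂ refl
other-port {suc zero} {zero}     _ zero       = inj₂ refl
other-port {suc zero} {zero}     _ (suc zero) = inj₁ refl

loop-all : ∀ (G : DartGraph n 2) {v} → vertex (mate G (v , zero)) ≡ v → ∀ k → vertex (mate G (v , k)) ≡ v
loop-all G {v} closed k with mate G (v , zero) in eq
loop-all G {v} refl   k | .v , l with other-port {zero} {l} (λ { refl → mate-irrefl G _ eq }) k
... | inj₁ refl = cong vertex eq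
... | inj₂ refl = cong vertex (mate-swap G eq)

module _ (G : DartGraph (suc n) 2) (closed : vertex (mate G (zero , zero)) ≡ zero) where

  private
    shift : Dart n 2 → Dart (suc n) 2
    shift (v , k) = suc v , k

    shift-injective : ∀ {x y} → shift x ≡ shift y → x ≡ y
    shift-injective refl = refl

    rest : ∀ x → ∃[ y ] mate G (shift x) ≡ shift y
    rest (v , k) with mate G (suc v , k) in eq
    ... | suc u , l = (u , l) , refl
    ... | zero , l with () ← trans (sym (cong vertex (mate-swap G eq))) (loop-all G closed l)

  drop-loop : DartGraph n 2
  mate drop-loop x = proj₁ (rest x)
  mate-involutive drop-loop x = shift-injective
    (trans (sym (proj₂ (rest (proj₁ (rest x))))) (mate-swap G (proj₂ (rest x))))
  mate-irrefl drop-loop x eq = mate-irrefl G (shift x) (trans (proj₂ (rest x)) (cong shift eq))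

  longCycles-drop : ∀ {w} → LongCycles G w → LongCycles drop-loop (w ∘ suc)
  positive (longCycles-drop lc) v       = positive lc _
  loop     (longCycles-drop lc) x l     = loop lc (shift x) (trans (cong vertex (proj₂ (rest x))) (cong suc l))
  triangle (longCycles-drop lc) x y z t = triangle lc (shift x) (shift y) (shift z) record
    { xy = trans (cong suc (xy t)) (sym (cong vertex (proj₂ (rest x))))
    ; yz = trans (cong suc (yz t)) (sym (cong vertex (proj₂ (rest y))))
    ; zx = trans (cong suc (zx t)) (sym (cong vertex (proj₂ (rest z))))
    }

  -- The two darts of a loop get different colours, so the loop is lost and is counted once from
  -- each dart. This is the one lost edge of an odd cycle.
  colouring-drop : ∀ c → ∃[ c′ ] conflicts G c′ ≤ 2 + conflicts drop-loop c
  colouring-drop c = c′ , +-mono-≤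
      (+-mono-≤ (differ≤1 zero (colour c′ (mate G (zero , zero))))
        (+-mono-≤ (differ≤1 (suc zero) (colour c′ (mate G (zero , suc zero)))) z≤n))
      (≤-reflexive (sumᴰ-cong λ x → cong (differ (colour c x) ∘ colour c′) (proj₂ (rest x))))
    where
    c′ : Colouring (suc n) 2
    colour c′ (zero , k)  = k
    colour c′ (suc v , k) = colour c (v , k)
    proper c′ {zero}  eq  = eq
    proper c′ {suc v} eq  = proper c eq

-- Each conflicting edge is counted twice by conflicts, hence the factor 2.
record FewConflicts (a : ℕ) (G : DartGraph n d) (w : Fin n → ℕ) : Set where
  field
    colouring : Colouring n d
    bound     : a * conflicts G colouring ≤ 2 * sum w

open FewConflicts

fewConflicts-transfer : ∀ {a} (G : DartGraph n d) (G′ : DartGraph n′ d′) w w′ →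
  (∀ c → ∃[ c′ ] conflicts G c′ ≡ conflicts G′ c) → sum w′ ≤ sum w →
  FewConflicts a G′ w′ → FewConflicts a G w
fewConflicts-transfer {a = a} G G′ w w′ lift w′≤w few = record
  { colouring = proj₁ (lift (colouring few))
  ; bound     = ≤-trans (subst (λ k → a * k ≤ 2 * sum w′) (sym (proj₂ (lift (colouring few)))) (bound few))
      (*-monoʳ-≤ 2 w′≤w)
  }

fewConflicts-relabel : ∀ {a} (G : DartGraph n d) R w →
                       FewConflicts a (relabel G R) (w ∘ (π R ⟨$⟩ʳ_)) → FewConflicts a G w
fewConflicts-relabel G R w = fewConflicts-transfer G (relabel G R) w _ (colouring-relabel G R)
  (≤-reflexive (sym (sum-permute w (π R))))

fewConflicts-drop : ∀ (G : DartGraph (suc n) 2) closed w → LongCycles G w →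
                    FewConflicts 5 (drop-loop G closed) (w ∘ suc) → FewConflicts 5 G w
fewConflicts-drop G closed w lc few = record
  { colouring = proj₁ lift
  ; bound     = begin
      5 * conflicts G (proj₁ lift)                               ≤⟨ *-monoʳ-≤ 5 (proj₂ lift) ⟩
      5 * (2 + conflicts (drop-loop G closed) (colouring few))   ≡⟨ *-distribˡ-+ 5 2 _ ⟩
      -- The loop pays for itself: 5 times its two conflicts is at most twice its weight, which is
      -- at least 5.
      10 + 5 * conflicts (drop-loop G closed) (colouring few)    ≤⟨ +-mono-≤ (*-monoʳ-≤ 2 (loop lc (zero , zero) closed)) (bound few) ⟩
      2 * w zero + 2 * sum (w ∘ suc)                             ≡⟨ *-distribˡ-+ 2 (w zero) _ ⟨
      2 * sum w                                                  ∎
  }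
  where
  open ≤-Reasoning
  lift = colouring-drop G closed (colouring few)

twoRegular-step : ∀ (G : DartGraph (2 + n) 2) → vertex (mate G (zero , zero)) ≢ zero →
  (∀ (G′ : DartGraph n 2) w → LongCycles G′ w → FewConflicts 5 G′ w) →
  ∀ w → LongCycles G w → FewConflicts 5 G w
twoRegular-step {n} G out ih w lc
  with relabelling₂ (out ∘ sym) Perm.id (transpose zero (port (mate G (zero , zero))))
... | R , R0 , R1 = fewConflicts-relabel G R w
  (reduce (longCycles-suppress (relabel G R) inner _ (longCycles-relabel G R lc)))
  where
  inner : Inner (relabel G R) zero
  inner = relabel-mate G R (trans (cong (mate G) (R0 zero)) (sym (R1 zero)))

  reduce : (∃[ w′ ] LongCycles (suppressed (relabel G R) inner) w′ × sum w′ ≤ sum (w ∘ (π R ⟨$⟩ʳ_))) →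
           FewConflicts 5 (relabel G R) (w ∘ (π R ⟨$⟩ʳ_))
  reduce (w′ , lc′ , w′≤) = fewConflicts-transfer (relabel G R) (suppressed (relabel G R) inner) _ w′
    (colouring-suppress₂ (relabel G R) inner) w′≤ (ih (suppressed (relabel G R) inner) w′ lc′)

-- Suppressing two neighbours shortens a cycle by two at no cost. An even cycle thus disappears
-- without conflict, and an odd one ends as a loop, which is dropped.
twoRegular-fewConflicts : ∀ n (G : DartGraph n 2) w → LongCycles G w → FewConflicts 5 G w
twoRegular-fewConflicts zero G w lc = record { colouring = portColouring ; bound = z≤n }
twoRegular-fewConflicts (suc n) G w lc = by n G w lc (vertex (mate G (zero , zero)) ≟ zero)
  where
  by : ∀ n (G : DartGraph (suc n) 2) w → LongCycles G w → Dec (vertex (mate G (zero , zero)) ≡ zero) →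
       FewConflicts 5 G w
  by n G w lc (yes closed) = fewConflicts-drop G closed w lc
    (twoRegular-fewConflicts n (drop-loop G closed) (w ∘ suc) (longCycles-drop G closed lc))
  by zero G w lc (no out) with mate G (zero , zero)
  ... | zero , _ = contradiction refl out
  by (suc n) G w lc (no out) = twoRegular-step G out (twoRegular-fewConflicts n) w lc

-- Deciding whether there is a cut edge

crosses? : ∀ (G : DartGraph n d) S x → Dec (Crosses G S x)
crosses? G S x = ¬? (S _ Bool.≟ S _)

cutEdge? : ∀ (G : DartGraph n d) S x → Dec (CutEdge G S x)
cutEdge? G S x = map′
  (λ (cr , only) → record { crosses = cr ; only = λ (v , k) → only v k })
  (λ ce → crosses ce , λ v k → only ce (v , k))
  (crosses? G S x ×-dec all? λ v → all? λ k →
    crosses? G S (v , k) →-dec (((v , k) ≟ᴰ x) ⊎-dec ((v , k) ≟ᴰ mate G x)))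

-- Stands in for function extensionality: the search in `noCutEdge?` runs over vectors, whose
-- `lookup` agrees with a given `S` only pointwise.
cutEdge-cong : ∀ (G : DartGraph n d) {S S′ x} → (∀ v → S v ≡ S′ v) → CutEdge G S x → CutEdge G S′ x
crosses (cutEdge-cong G S≗S′ ce) eq = crosses ce (trans (S≗S′ _) (trans eq (sym (S≗S′ _))))
only    (cutEdge-cong G S≗S′ ce) y cr = only ce y λ eq → cr (trans (sym (S≗S′ _)) (trans eq (S≗S′ _)))

noCutEdge? : ∀ (G : DartGraph n d) → (∃[ S ] ∃[ x ] CutEdge G S x) ⊎ NoCutEdge G
noCutEdge? G with anySubset? (λ p → any? λ v → any? λ k → cutEdge? G (lookup p) (v , k))
... | yes (p , v , k , ce) = inj₁ (lookup p , (v , k) , ce)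
... | no none = inj₂ λ S (v , k) ce →
  none (tabulate S , v , k , cutEdge-cong G (λ u → sym (lookup∘tabulate S u)) ce)

-- Frink's reduction

≢-≢⇒≡ : ∀ {p q r : Bool} → p ≢ q → q ≢ r → p ≡ r
≢-≢⇒≡ {true}  {true}          p≢q _   = contradiction refl p≢q
≢-≢⇒≡ {false} {false}         p≢q _   = contradiction refl p≢q
≢-≢⇒≡ {true}  {false} {true}  _   _   = refl
≢-≢⇒≡ {true}  {false} {false} _   q≢r = contradiction refl q≢r
≢-≢⇒≡ {false} {true}  {false} _   _   = refl
≢-≢⇒≡ {false} {true}  {true}  _   q≢r = contradiction refl q≢r

-- Only edges of `G` away from the vertices 0 and 1 are mentioned. Such edges survive in both
-- joinings, so the cuts found in the two splices can be compared inside `G`.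
record DirectCut (G : DartGraph (2 + n) d) (S : Fin n → Bool) : Set where
  field
    {near far} : Dart n d
    joined     : mate G (keep near) ≡ keep far
    crossing   : S (vertex near) ≢ S (vertex far)
    unique     : ∀ {z w} → mate G (keep z) ≡ keep w → S (vertex z) ≢ S (vertex w) → z ≡ near ⊎ z ≡ far

-- Splicing this configuration leaves the edges a₁b₁ and a₂b₂ in its place; after an exchange of the
-- ports 1 and 2 of vertex 1 it leaves a₁b₂ and a₂b₁ instead.
record Frink (G : DartGraph (2 + n) 3) : Set where
  field
    inner         : Inner G 0F
    {a₁ a₂ b₁ b₂} : Dart n 3
    ma₁           : mate G (0F , 1F) ≡ keep a₁
    ma₂           : mate G (0F , 2F) ≡ keep a₂
    mb₁           : mate G (1F , 1F) ≡ keep b₁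
    mb₂           : mate G (1F , 2F) ≡ keep b₂

  rungs : ∀ k → Inner G k ⊎ Outer G k
  rungs 0F = inj₁ inner
  rungs 1F = inj₂ ((a₁ , ma₁) , b₁ , mb₁)
  rungs 2F = inj₂ ((a₂ , ma₂) , b₂ , mb₂)

  data Spoke : Dart (2 + n) 3 → Dart n 3 → Set where
    spoke-a₁ : Spoke (0F , 1F) a₁
    spoke-a₂ : Spoke (0F , 2F) a₂
    spoke-b₁ : Spoke (1F , 1F) b₁
    spoke-b₂ : Spoke (1F , 2F) b₂

  spoke-mate : ∀ {y x} → Spoke y x → mate G y ≡ keep x
  spoke-mate spoke-a₁ = ma₁
  spoke-mate spoke-a₂ = ma₂
  spoke-mate spoke-b₁ = mb₁
  spoke-mate spoke-b₂ = mb₂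

  spoke-unique : ∀ {y y′ x} → Spoke y x → Spoke y′ x → y ≡ y′
  spoke-unique p q = mate-injective G (trans (spoke-mate p) (sym (spoke-mate q)))

  spoke-not-direct : ∀ {y x w} → Spoke y x → mate G (keep x) ≢ keep w
  spoke-not-direct spoke-a₁ p with () ← trans (sym p) (mate-swap G ma₁)
  spoke-not-direct spoke-a₂ p with () ← trans (sym p) (mate-swap G ma₂)
  spoke-not-direct spoke-b₁ p with () ← trans (sym p) (mate-swap G mb₁)
  spoke-not-direct spoke-b₂ p with () ← trans (sym p) (mate-swap G mb₂)

  data Position : Dart (2 + n) 3 → Set where
    axle₀  : Position (0F , 0F)
    axle₁  : Position (1F , 0F)
    spoke  : ∀ {y x} → Spoke y x → Position y
    rim    : ∀ {y x} → Spoke y x → Position (keep x)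
    direct : ∀ {z w} → mate G (keep z) ≡ keep w → Position (keep z)

  position : ∀ y → Position y
  position (0F , 0F) = axle₀
  position (0F , 1F) = spoke spoke-a₁
  position (0F , 2F) = spoke spoke-a₂
  position (1F , 0F) = axle₁
  position (1F , 1F) = spoke spoke-b₁
  position (1F , 2F) = spoke spoke-b₂
  position (suc (suc v) , k) with mate G (suc (suc v) , k) in eq
  ... | suc (suc w) , l = direct eq
  ... | 0F , 0F with () ← trans (sym inner) (mate-swap G eq)
  ... | 0F , 1F = subst Position (trans (sym ma₁) (mate-swap G eq)) (rim spoke-a₁)
  ... | 0F , 2F = subst Position (trans (sym ma₂) (mate-swap G eq)) (rim spoke-a₂)
  ... | 1F , 0F with () ← trans (sym (mate-swap G inner)) (mate-swap G eq)
  ... | 1F , 1F = subst Position (trans (sym mb₁) (mate-swap G eq)) (rim spoke-b₁)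
  ... | 1F , 2F = subst Position (trans (sym mb₂) (mate-swap G eq)) (rim spoke-b₂)

  -- With 0 and 1 on the same side the axle does not cross, and a rim dart crosses exactly when its
  -- spoke does. Spokes and direct edges are all that remains to be checked.
  cutEdge-extend : ∀ {S s r} → Crosses G (extend s s S) r →
    (∀ {y x} → Spoke y x → s ≢ S (vertex x) → y ≡ r ⊎ y ≡ mate G r) →
    (∀ {z w} → mate G (keep z) ≡ keep w → S (vertex z) ≢ S (vertex w) → keep z ≡ r ⊎ keep z ≡ mate G r) →
    CutEdge G (extend s s S) r
  crosses (cutEdge-extend cr spokes directs) = cr
  only (cutEdge-extend {S} {s} {r} cr spokes directs) y cry = by (position y) cry
    where
    ext = extend s s S

    at-spoke : ∀ {y x} → Spoke y x → Crosses G ext y → s ≢ S (vertex x)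
    at-spoke spoke-a₁ cr eq = cr (trans eq (cong (ext ∘ vertex) (sym ma₁)))
    at-spoke spoke-a₂ cr eq = cr (trans eq (cong (ext ∘ vertex) (sym ma₂)))
    at-spoke spoke-b₁ cr eq = cr (trans eq (cong (ext ∘ vertex) (sym mb₁)))
    at-spoke spoke-b₂ cr eq = cr (trans eq (cong (ext ∘ vertex) (sym mb₂)))

    by : ∀ {y} → Position y → Crosses G ext y → y ≡ r ⊎ y ≡ mate G r
    by axle₀ cr = contradiction (cong (ext ∘ vertex) (sym inner)) cr
    by axle₁ cr = contradiction (cong (ext ∘ vertex) (sym (mate-swap G inner))) cr
    by (spoke p) cr = spokes p (at-spoke p cr)
    by (rim {y} p) cr with spokes p (at-spoke p λ eq → cr (trans (cong (ext ∘ vertex) (sym (spoke-mate p)))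
        (trans (sym eq) (cong (ext ∘ vertex) (sym (mate-swap G (spoke-mate p)))))))
    ... | inj₁ refl = inj₂ (sym (spoke-mate p))
    ... | inj₂ refl = inj₁ (trans (sym (spoke-mate p)) (mate-involutive G r))
    by (direct p) cr = directs p λ eq → cr (trans eq (cong (ext ∘ vertex) (sym p)))

module _ (G : DartGraph (2 + n) 3) (F : Frink G) (nce : NoCutEdge G) where
  open Frink F

  private
    G′ = splice G rungs

    a₁↔b₁ : mate G′ a₁ ≡ b₁
    a₁↔b₁ = mate-splice G rungs (via₀ 1F ma₁ mb₁)

    a₂↔b₂ : mate G′ a₂ ≡ b₂
    a₂↔b₂ = mate-splice G rungs (via₀ 2F ma₂ mb₂)

    kept : ∀ {z w} → mate G (keep z) ≡ keep w → mate G′ z ≡ w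
    kept p = mate-splice G rungs (direct p)

  module _ {S d} (ce : CutEdge G′ S d) where

    private
      direct-crosses : ∀ {z w} → mate G (keep z) ≡ keep w → S (vertex z) ≢ S (vertex w) → z ≡ d ⊎ z ≡ mate G′ d
      direct-crosses {z} p ne = only ce z λ eq → ne (trans eq (cong (S ∘ vertex) (kept p)))

    module _ (p : mate G (keep d) ≡ keep (mate G′ d)) where

      private
        no-spoke : ∀ {y x} → Spoke y x → x ≡ d ⊎ x ≡ mate G′ d → S (vertex x) ≡ S (vertex (mate G′ x))
        no-spoke s (inj₁ refl) = contradiction p (spoke-not-direct s)
        no-spoke s (inj₂ refl) = contradiction (mate-swap G p) (spoke-not-direct s)

        uncrossed : ∀ {y x} → Spoke y x → S (vertex x) ≡ S (vertex (mate G′ x))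
        uncrossed {x = x} s with S (vertex x) Bool.≟ S (vertex (mate G′ x))
        ... | yes eq = eq
        ... | no ne  = no-spoke s (only ce x ne)

      direct-level₁ : S (vertex a₁) ≡ S (vertex b₁)
      direct-level₁ = trans (uncrossed spoke-a₁) (cong (S ∘ vertex) a₁↔b₁)

      direct-level₂ : S (vertex a₂) ≡ S (vertex b₂)
      direct-level₂ = trans (uncrossed spoke-a₂) (cong (S ∘ vertex) a₂↔b₂)

      -- Each new edge has both ends on one side. If the two sides were equal, 0 and 1 could be put
      -- there as well, no spoke would cross, and the cut edge of the splice would be a cut edge of
      -- `G`.
      direct-split : S (vertex a₁) ≢ S (vertex a₂)
      direct-split a₁≡a₂ = nce (extend (S (vertex a₁)) (S (vertex a₁)) S) (keep d)
        (cutEdge-extend (λ eq → crosses ce (trans eq (cong (extend _ _ S ∘ vertex) p)))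
          (λ s ne → contradiction (level s) ne)
          (λ q ne → Sum.map (cong keep) (λ eq → trans (cong keep eq) (sym p)) (direct-crosses q ne)))
        where
        level : ∀ {y x} → Spoke y x → S (vertex a₁) ≡ S (vertex x)
        level spoke-a₁ = refl
        level spoke-a₂ = a₁≡a₂
        level spoke-b₁ = direct-level₁
        level spoke-b₂ = trans a₁≡a₂ direct-level₂

      directCut : DirectCut G S
      directCut = record
        { joined   = p
        ; crossing = crosses ce
        ; unique   = direct-crosses
        }

    -- A new edge a b as the only edge of a cut: choose the side of 0 and 1 so that only one
    -- of the edges from them to a and b crosses.
    not-new : ∀ {a b a′ b′ y₀ y₁} → mate G′ a ≡ b → mate G′ a′ ≡ b′ → Spoke y₀ a → Spoke y₁ b →
              (∀ {y x} → Spoke y x → x ≡ a ⊎ x ≡ b ⊎ x ≡ a′ ⊎ x ≡ b′) → a′ ≢ a → a′ ≢ b →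
              ¬ (d ≡ a ⊎ d ≡ b)
    not-new {a} {b} {a′} {b′} {y₀} {y₁} ab a′b′ sa sb cases a′≢a a′≢b at = by (S (vertex a) Bool.≟ s)
      where
      -- The other new edge does not cross, so both of its ends lie on this side and their spokes
      -- stay uncrossed.
      s   = S (vertex a′)
      ext = extend s s S

      on-edge : ∀ {x} → x ≡ d ⊎ x ≡ mate G′ d → x ≡ a ⊎ x ≡ b
      on-edge (inj₁ x≡d)  = Sum.map (trans x≡d) (trans x≡d) at
      on-edge (inj₂ x≡d′) = [ (λ d≡a → inj₂ (trans x≡d′ (trans (cong (mate G′) d≡a) ab)))
                         , (λ d≡b → inj₁ (trans x≡d′ (trans (cong (mate G′) d≡b) (mate-swap G′ ab)))) ]′ at

      level : s ≡ S (vertex b′)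
      level with s Bool.≟ S (vertex b′)
      ... | yes eq = eq
      ... | no ne with on-edge (only ce a′ λ eq → ne (trans eq (cong (S ∘ vertex) a′b′)))
      ...   | inj₁ eq = contradiction eq a′≢a
      ...   | inj₂ eq = contradiction eq a′≢b

      split : S (vertex a) ≢ S (vertex b)
      split eq = crosses ce ([ (λ d≡a → trans (side d≡a) (trans eq (sym (side (trans (cong (mate G′) d≡a) ab)))))
                             , (λ d≡b → trans (side d≡b) (trans (sym eq)
                                 (sym (side (trans (cong (mate G′) d≡b) (mate-swap G′ ab)))))) ]′ at)
        where
        side : ∀ {x y} → x ≡ y → S (vertex x) ≡ S (vertex y)
        side = cong (S ∘ vertex)

      no-direct : ∀ {z w} {A : Set} → mate G (keep z) ≡ keep w → S (vertex z) ≢ S (vertex w) → A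
      no-direct p ne with on-edge (direct-crosses p ne)
      ... | inj₁ refl = contradiction p (spoke-not-direct sa)
      ... | inj₂ refl = contradiction p (spoke-not-direct sb)

      spoke-side : ∀ {y x} → Spoke y x → s ≡ ext (vertex y)
      spoke-side spoke-a₁ = refl
      spoke-side spoke-a₂ = refl
      spoke-side spoke-b₁ = refl
      spoke-side spoke-b₂ = refl

      cut : ∀ {y x} → Spoke y x → s ≢ S (vertex x) →
            (∀ {y′ x′} → Spoke y′ x′ → s ≢ S (vertex x′) → x′ ≡ x) → CutEdge G ext y
      cut sp ne others = cutEdge-extend
        (λ eq → ne (trans (spoke-side sp) (trans eq (cong (ext ∘ vertex) (spoke-mate sp)))))
        (λ sp′ ne′ → inj₁ (spoke-unique (subst (Spoke _) (others sp′ ne′) sp′) sp))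
        no-direct

      by : Dec (S (vertex a) ≡ s) → _
      by (yes a≡s) = nce ext y₁ (cut sb (λ eq → split (trans a≡s eq)) others)
        where
        others : ∀ {y x} → Spoke y x → s ≢ S (vertex x) → x ≡ b
        others sp ne with cases sp
        ... | inj₁ refl               = contradiction (sym a≡s) ne
        ... | inj₂ (inj₁ x≡b)         = x≡b
        ... | inj₂ (inj₂ (inj₁ refl)) = contradiction refl ne
        ... | inj₂ (inj₂ (inj₂ refl)) = contradiction level ne
      by (no a≢s) = nce ext y₀ (cut sa (a≢s ∘ sym) others)
        where
        others : ∀ {y x} → Spoke y x → s ≢ S (vertex x) → x ≡ a
        others sp ne with cases sp
        ... | inj₁ x≡a                = x≡a
        ... | inj₂ (inj₁ refl)        = contradiction (≢-≢⇒≡ (a≢s ∘ sym) split) ne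
        ... | inj₂ (inj₂ (inj₁ refl)) = contradiction refl ne
        ... | inj₂ (inj₂ (inj₂ refl)) = contradiction level ne

    private
      distinct : ∀ {y y′ x x′} → Spoke y x → Spoke y′ x′ → y ≢ y′ → x ≢ x′
      distinct p q y≢y′ refl = y≢y′ (spoke-unique p q)

      new₁ : ¬ (d ≡ a₁ ⊎ d ≡ b₁)
      new₁ = not-new a₁↔b₁ a₂↔b₂ spoke-a₁ spoke-b₁
        (λ { spoke-a₁ → inj₁ refl ; spoke-b₁ → inj₂ (inj₁ refl)
           ; spoke-a₂ → inj₂ (inj₂ (inj₁ refl)) ; spoke-b₂ → inj₂ (inj₂ (inj₂ refl)) })
        (distinct spoke-a₂ spoke-a₁ λ ()) (distinct spoke-a₂ spoke-b₁ λ ())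

      new₂ : ¬ (d ≡ a₂ ⊎ d ≡ b₂)
      new₂ = not-new a₂↔b₂ a₁↔b₁ spoke-a₂ spoke-b₂
        (λ { spoke-a₂ → inj₁ refl ; spoke-b₂ → inj₂ (inj₁ refl)
           ; spoke-a₁ → inj₂ (inj₂ (inj₁ refl)) ; spoke-b₁ → inj₂ (inj₂ (inj₂ refl)) })
        (distinct spoke-a₁ spoke-a₂ λ ()) (distinct spoke-a₁ spoke-b₂ λ ())

    cutEdge-direct : mate G (keep d) ≡ keep (mate G′ d)
    cutEdge-direct with splice-link G rungs d
    ... | direct p = p
    ... | via₀ 0F p _ with () ← trans (sym p) inner
    ... | via₁ 0F _ p with () ← trans (sym p) inner
    ... | via₀ 1F p q = ⊥-elim (new₁ (inj₁ (keep-injective (trans (sym p) ma₁))))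
    ... | via₁ 1F p q = ⊥-elim (new₁ (inj₂ (keep-injective (trans (sym p) mb₁))))
    ... | via₀ 2F p q = ⊥-elim (new₂ (inj₁ (keep-injective (trans (sym p) ma₂))))
    ... | via₁ 2F p q = ⊥-elim (new₂ (inj₂ (keep-injective (trans (sym p) mb₂))))

open Frink
open DirectCut

module _ (G : DartGraph (2 + n) d) {S₁ S₂ : Fin n → Bool} (D₁ : DirectCut G S₁) (D₂ : DirectCut G S₂) where

  -- The two cut edges have at most four ends; since neither crosses the cut of the other unless
  -- they coincide, some quadrant of S₁ and S₂ contains none of them.
  unmet-quadrant : ∃[ p ] ∃[ q ] (∀ {z w} → mate G (keep z) ≡ keep w →
    S₁ (vertex z) ≡ p → S₂ (vertex z) ≡ q → S₁ (vertex w) ≡ p × S₂ (vertex w) ≡ q)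
  unmet-quadrant with S₂ (vertex (near D₁)) Bool.≟ S₂ (vertex (far D₁))
  -- The edge of `D₁` stays on one side of `S₂`, and `q` is the other side. The choice of `p`
  -- excludes the near end of the edge of `D₂`. It excludes the far end too: an edge that crosses
  -- `S₁` is that of `D₁`, which `q` has excluded already.
  ... | yes flat = not (S₁ (vertex (near D₂))) , not (S₂ (vertex (near D₁))) , closed
    where
    closed : ∀ {z w} → mate G (keep z) ≡ keep w →
      S₁ (vertex z) ≡ not (S₁ (vertex (near D₂))) → S₂ (vertex z) ≡ not (S₂ (vertex (near D₁))) →
      S₁ (vertex w) ≡ not (S₁ (vertex (near D₂))) × S₂ (vertex w) ≡ not (S₂ (vertex (near D₁)))
    closed {z} {w} zw z₁ z₂ with S₁ (vertex z) Bool.≟ S₁ (vertex w)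
    ... | no ne with unique D₁ zw ne
    ...   | inj₁ refl = contradiction z₂ (Bool.not-¬ refl)
    ...   | inj₂ refl = contradiction z₂ (Bool.not-¬ (sym flat))
    closed {z} {w} zw z₁ z₂ | yes eq₁ with S₂ (vertex z) Bool.≟ S₂ (vertex w)
    ... | yes eq₂ = trans (sym eq₁) z₁ , trans (sym eq₂) z₂
    ... | no ne with unique D₂ zw ne
    ...   | inj₁ refl = contradiction z₁ (Bool.not-¬ refl)
    ...   | inj₂ refl with refl ← trans (sym zw) (mate-swap G (joined D₂)) =
      contradiction z₁ (Bool.not-¬ eq₁)
  -- An edge that crosses both cuts is the cut edge of both. Its ends lie in opposite quadrants, and
  -- one of the two remaining quadrants is taken.
  ... | no across = S₁ (vertex (near D₁)) , not (S₂ (vertex (near D₁))) , closed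
    where
    closed : ∀ {z w} → mate G (keep z) ≡ keep w →
      S₁ (vertex z) ≡ S₁ (vertex (near D₁)) → S₂ (vertex z) ≡ not (S₂ (vertex (near D₁))) →
      S₁ (vertex w) ≡ S₁ (vertex (near D₁)) × S₂ (vertex w) ≡ not (S₂ (vertex (near D₁)))
    closed {z} {w} zw z₁ z₂ = by (S₁ (vertex z) Bool.≟ S₁ (vertex w)) (S₂ (vertex z) Bool.≟ S₂ (vertex w))
      where
      not-D₁ : ¬ (z ≡ near D₁ ⊎ z ≡ far D₁)
      not-D₁ (inj₁ refl) = contradiction z₂ (Bool.not-¬ refl)
      not-D₁ (inj₂ refl) = crossing D₁ (sym z₁)

      not-D₂ : ¬ (z ≡ near D₂ ⊎ z ≡ far D₂)
      not-D₂ z∈ with unique D₂ (joined D₁) across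
      not-D₂ (inj₁ refl) | inj₁ eq = not-D₁ (inj₁ (sym eq))
      not-D₂ (inj₂ refl) | inj₂ eq = not-D₁ (inj₁ (sym eq))
      not-D₂ (inj₁ refl) | inj₂ eq = not-D₁ (inj₂ (keep-injective
        (trans (sym (mate-swap G (joined D₂))) (trans (cong (mate G ∘ keep) (sym eq)) (joined D₁)))))
      not-D₂ (inj₂ refl) | inj₁ eq = not-D₁ (inj₂ (keep-injective
        (trans (sym (joined D₂)) (trans (cong (mate G ∘ keep) (sym eq)) (joined D₁)))))

      by : Dec (S₁ (vertex z) ≡ S₁ (vertex w)) → Dec (S₂ (vertex z) ≡ S₂ (vertex w)) → _
      by (yes eq₁) (yes eq₂) = trans (sym eq₁) z₁ , trans (sym eq₂) z₂
      by (no ne)   _         = contradiction (unique D₁ zw ne) not-D₁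
      by (yes _)   (no ne)   = contradiction (unique D₂ zw ne) not-D₂

  module _ (p q : Bool) where

    inQuadrant : Fin n → Bool
    inQuadrant v = does (S₁ v Bool.≟ p) ∧ does (S₂ v Bool.≟ q)

    inQuadrant-true : ∀ {v} → S₁ v ≡ p → S₂ v ≡ q → inQuadrant v ≡ true
    inQuadrant-true refl refl = cong₂ _∧_ (dec-true (p Bool.≟ p) refl) (dec-true (q Bool.≟ q) refl)

    inQuadrant-true⁻¹ : ∀ {v} → inQuadrant v ≡ true → S₁ v ≡ p × S₂ v ≡ q
    inQuadrant-true⁻¹ {v} eq with S₁ v Bool.≟ p | S₂ v Bool.≟ q
    ... | yes e₁ | yes e₂ = e₁ , e₂

-- The four spokes end in the four quadrants of S₁ and S₂, so that exactly one edge leaves a quadrant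
-- that the two cut edges do not meet.
uncross : ∀ (G : DartGraph (2 + n) 3) (F : Frink G) {S₁ S₂} → NoCutEdge G →
  DirectCut G S₁ → DirectCut G S₂ →
  S₁ (vertex (a₁ F)) ≡ S₁ (vertex (b₁ F)) → S₁ (vertex (a₂ F)) ≡ S₁ (vertex (b₂ F)) →
  S₁ (vertex (a₁ F)) ≢ S₁ (vertex (a₂ F)) →
  S₂ (vertex (a₁ F)) ≡ S₂ (vertex (b₂ F)) → S₂ (vertex (a₂ F)) ≡ S₂ (vertex (b₁ F)) →
  ¬ S₂ (vertex (a₁ F)) ≢ S₂ (vertex (a₂ F))
uncross G F {S₁} {S₂} nce D₁ D₂ a₁b₁ a₂b₂ a₁a₂ a₁b₂ a₂b₁ a₁a₂′ with unmet-quadrant G D₁ D₂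
... | p , q , unmet = [ (λ e₁ → [ (λ e₂ → no-spoke spoke-a₁ e₁ e₂)
                                , (λ e₂ → no-spoke spoke-b₁ (trans (sym a₁b₁) e₁) (trans (sym a₂b₁) e₂)) ]′ pick₂)
                      , (λ e₁ → [ (λ e₂ → no-spoke spoke-b₂ (trans (sym a₂b₂) e₁) (trans (sym a₁b₂) e₂))
                                , (λ e₂ → no-spoke spoke-a₂ e₁ e₂) ]′ pick₂) ]′ pick₁
  where
  R : Fin _ → Bool
  R = inQuadrant G D₁ D₂ p q

  pick : ∀ {s t} r → s ≢ t → s ≡ r ⊎ t ≡ r
  pick {s} r s≢t with s Bool.≟ r
  ... | yes eq = inj₁ eq
  ... | no ne  = inj₂ (≢-≢⇒≡ (s≢t ∘ sym) ne)

  pick₁ = pick p a₁a₂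
  pick₂ = pick q a₁a₂′

  apart : ∀ {y x y′ x′} → Spoke F y x → Spoke F y′ x′ → S₁ (vertex x) ≡ S₁ (vertex x′) →
          S₂ (vertex x) ≡ S₂ (vertex x′) → y ≡ y′
  apart spoke-a₁ spoke-a₁ _ _ = refl
  apart spoke-a₁ spoke-a₂ e _ = contradiction e a₁a₂
  apart spoke-a₁ spoke-b₁ _ e = contradiction (trans e (sym a₂b₁)) a₁a₂′
  apart spoke-a₁ spoke-b₂ e _ = contradiction (trans e (sym a₂b₂)) a₁a₂
  apart spoke-a₂ spoke-a₁ e _ = contradiction (sym e) a₁a₂
  apart spoke-a₂ spoke-a₂ _ _ = refl
  apart spoke-a₂ spoke-b₁ e _ = contradiction (trans a₁b₁ (sym e)) a₁a₂
  apart spoke-a₂ spoke-b₂ _ e = contradiction (trans a₁b₂ (sym e)) a₁a₂′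
  apart spoke-b₁ spoke-a₁ _ e = contradiction (trans (sym e) (sym a₂b₁)) a₁a₂′
  apart spoke-b₁ spoke-a₂ e _ = contradiction (trans a₁b₁ e) a₁a₂
  apart spoke-b₁ spoke-b₁ _ _ = refl
  apart spoke-b₁ spoke-b₂ e _ = contradiction (trans a₁b₁ (trans e (sym a₂b₂))) a₁a₂
  apart spoke-b₂ spoke-a₁ e _ = contradiction (trans (sym e) (sym a₂b₂)) a₁a₂
  apart spoke-b₂ spoke-a₂ _ e = contradiction (trans a₁b₂ e) a₁a₂′
  apart spoke-b₂ spoke-b₁ e _ = contradiction (trans a₁b₁ (trans (sym e) (sym a₂b₂))) a₁a₂
  apart spoke-b₂ spoke-b₂ _ _ = refl

  not-false : ∀ {r} → false ≢ r → r ≡ true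
  not-false {true}  _ = refl
  not-false {false} f = contradiction refl f

  level : ∀ {z w} → mate G (keep z) ≡ keep w → R (vertex z) ≡ true → R (vertex w) ≡ true
  level zw Rz with inQuadrant-true⁻¹ G D₁ D₂ p q Rz
  ... | z₁ , z₂ with unmet zw z₁ z₂
  ... | w₁ , w₂ = inQuadrant-true G D₁ D₂ p q w₁ w₂

  uncrossed : ∀ {z w} → mate G (keep z) ≡ keep w → R (vertex z) ≡ R (vertex w)
  uncrossed {z} {w} zw with R (vertex z) in eqz | R (vertex w) in eqw
  ... | true  | true  = refl
  ... | false | false = refl
  ... | true  | false = trans (sym (level zw eqz)) eqw
  ... | false | true  = trans (sym eqz) (level (mate-swap G zw) eqw)

  hub-side : ∀ {y x} → Spoke F y x → extend false false R (vertex y) ≡ false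
  hub-side spoke-a₁ = refl
  hub-side spoke-a₂ = refl
  hub-side spoke-b₁ = refl
  hub-side spoke-b₂ = refl

  no-spoke : ∀ {y x} → Spoke F y x → S₁ (vertex x) ≡ p → ¬ S₂ (vertex x) ≡ q
  no-spoke {y} sp e₁ e₂ = nce _ y (cutEdge-extend F
    (λ eq → Bool.not-¬ {true} refl (trans (sym (inQuadrant-true G D₁ D₂ p q e₁ e₂))
      (trans (cong (extend false false R ∘ vertex) (sym (spoke-mate F sp))) (trans (sym eq) (hub-side sp)))))
    (λ sp′ ne → inj₁ (by-quadrant sp′ (inQuadrant-true⁻¹ G D₁ D₂ p q (not-false ne))))
    (λ zw ne → contradiction (uncrossed zw) ne))
    where
    by-quadrant : ∀ {y′ x′} → Spoke F y′ x′ → S₁ (vertex x′) ≡ p × S₂ (vertex x′) ≡ q → y′ ≡ y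
    by-quadrant sp′ (f₁ , f₂) = apart sp′ sp (trans f₁ (sym e₁)) (trans f₂ (sym e₂))

swap-ports : Relabelling (2 + n) 3
swap-ports {n} = record { π = Perm.id ; ρ = ports }
  where
  ports : Fin (2 + n) → Permutation 3 3
  ports 1F = transpose 1F 2F
  ports _  = Perm.id

module _ (G : DartGraph (2 + n) 3) (F : Frink G) where

  private
    Gˢ = relabel G swap-ports

  frink-swap : Frink Gˢ
  frink-swap = record
    { inner = relabel-mate G swap-ports (inner F)
    ; ma₁   = relabel-mate G swap-ports (ma₁ F)
    ; ma₂   = relabel-mate G swap-ports (ma₂ F)
    ; mb₁   = relabel-mate G swap-ports {1F , 1F} (mb₂ F)
    ; mb₂   = relabel-mate G swap-ports {1F , 2F} (mb₁ F)
    }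

  directCut-swap : ∀ {S} → DirectCut Gˢ S → DirectCut G S
  directCut-swap D = record
    { joined   = sym (trans (cong (to swap-ports) (sym (joined D))) (to-mate G swap-ports (keep (near D))))
    ; crossing = crossing D
    ; unique   = λ p → unique D (relabel-mate G swap-ports p)
    }
    where open DirectCut

  -- If both joinings had a cut edge, each would be an edge of `G` away from 0 and 1. The first cut
  -- separates `a₁`, `b₁` from `a₂`, `b₂`, the second `a₁`, `b₂` from `a₂`, `b₁`, and `uncross`
  -- refutes such a pair. Deciding the existence of a cut edge makes the disjunction constructive.
  frink-reduction : NoCutEdge G → NoCutEdge (splice G (rungs F)) ⊎ NoCutEdge (splice Gˢ (rungs frink-swap))
  frink-reduction nce with noCutEdge? (splice G (rungs F)) | noCutEdge? (splice Gˢ (rungs frink-swap))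
  ... | inj₂ ok | _       = inj₁ ok
  ... | inj₁ _  | inj₂ ok = inj₂ ok
  ... | inj₁ (S₁ , d₁ , ce₁) | inj₁ (S₂ , d₂ , ce₂) = ⊥-elim (uncross G F nce
      (directCut G F nce ce₁ dir₁)
      (directCut-swap (directCut Gˢ frink-swap nceˢ ce₂ dir₂))
      (direct-level₁ G F nce ce₁ dir₁) (direct-level₂ G F nce ce₁ dir₁) (direct-split G F nce ce₁ dir₁)
      (direct-level₁ Gˢ frink-swap nceˢ ce₂ dir₂) (direct-level₂ Gˢ frink-swap nceˢ ce₂ dir₂)
      (direct-split Gˢ frink-swap nceˢ ce₂ dir₂))
    where
    nceˢ = noCutEdge-relabel G swap-ports nce
    dir₁ = cutEdge-direct G F nce ce₁
    dir₂ = cutEdge-direct Gˢ frink-swap nceˢ ce₂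

-- Perfect matchings

-- The matching is given by the port at which it leaves each vertex.
record PerfectMatching (G : DartGraph n d) : Set where
  field
    choice : Fin n → Fin d

  Matched : Dart n d → Set
  Matched x = choice (vertex x) ≡ port x

  field
    closed : ∀ x → Matched x → Matched (mate G x)

open PerfectMatching

Avoidable : DartGraph n d → Dart n d → Set
Avoidable G x = Σ[ M ∈ PerfectMatching G ] ¬ Matched M x

matching-relabel : ∀ (G : DartGraph n d) R x → Avoidable (relabel G R) x → Avoidable G (to R x)
matching-relabel G R x (M , avoids) = M′ , λ m → avoids (subst (Matched M) (from-to R x) (pull _ m))
  where
  M′ : PerfectMatching G

  pull : ∀ y → Matched M′ y → Matched M (from R y)
  push : ∀ y → Matched M (from R y) → Matched M′ y

  choice M′ w   = ρ R (π R ⟨$⟩ˡ w) ⟨$⟩ʳ choice M (π R ⟨$⟩ˡ w)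
  closed M′ y m = push (mate G y) (subst (Matched M ∘ from R ∘ mate G) (to-from R y) (closed M (from R y) (pull y m)))

  pull y m = trans (sym (inverseˡ (ρ R (π R ⟨$⟩ˡ vertex y)))) (cong (ρ R (π R ⟨$⟩ˡ vertex y) ⟨$⟩ˡ_) m)
  push y m = trans (cong (ρ R (π R ⟨$⟩ˡ vertex y) ⟨$⟩ʳ_) m) (inverseʳ (ρ R (π R ⟨$⟩ˡ vertex y)))

-- A matched edge glued at port `k` falls apart into two matched edges, at `(0F , k)` and
-- `(1F , k)`, so both removed vertices leave at the same port `k₀`. The condition says that no
-- other glued edge is matched; if `k₀` is inner, none is, and 0 and 1 are matched to each other.
matching-splice : ∀ (G : DartGraph (2 + n) d) rungs (M : PerfectMatching (splice G rungs)) k₀ →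
  (∀ k {a} → mate G (0F , k) ≡ keep a → (Matched M a → k₀ ≡ k) × (k₀ ≡ k → Matched M a)) →
  Σ[ M′ ∈ PerfectMatching G ] choice M′ 0F ≡ k₀
matching-splice {n} {d} G rungs M k₀ fits = M′ , refl
  where
  choice′ : Fin (2 + n) → Fin d
  choice′ 0F            = k₀
  choice′ 1F            = k₀
  choice′ (suc (suc v)) = choice M v

  Matched′ : Dart (2 + n) d → Set
  Matched′ x = choice′ (vertex x) ≡ port x

  M′ : PerfectMatching G
  choice M′ = choice′
  closed M′ (0F , k) m with rungs k
  ... | inj₁ inner          = subst Matched′ (sym inner) m
  ... | inj₂ ((a , ma) , _) = subst Matched′ (sym ma) (proj₂ (fits k ma) m)
  closed M′ (1F , k) m with rungs k
  ... | inj₁ inner = subst Matched′ (sym (mate-swap G inner)) m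
  ... | inj₂ ((a , ma) , b , mb) = subst Matched′ (sym mb)
    (subst (Matched M) (mate-splice G rungs (via₀ k ma mb)) (closed M a (proj₂ (fits k ma) m)))
  closed M′ (suc (suc v) , j) m with splice-link G rungs (v , j)
  ... | direct p     = subst Matched′ (sym p) (closed M (v , j) m)
  ... | via₀ k ma mb = subst Matched′ (sym (mate-swap G ma)) (proj₁ (fits k ma) m)
  ... | via₁ k mb ma = subst Matched′ (sym (mate-swap G mb)) (proj₁ (fits k ma) (closed M (v , j) m))

-- The bare existence of a matching would not carry the induction: if both new edges of a splice
-- were matched, 0 and 1 would have to be matched twice. So the smaller graph is asked for a
-- matching that avoids one of them.
Petersen : ℕ → Set
Petersen n = ∀ (G : DartGraph n 3) → NoCutEdge G → ∀ x → Avoidable G x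

petersen-matching : Petersen n → ∀ (G : DartGraph n 3) → NoCutEdge G → PerfectMatching G
petersen-matching {zero}  ih G nce = record { choice = λ () ; closed = λ () }
petersen-matching {suc n} ih G nce = proj₁ (ih G nce (0F , 0F))

-- The matching of the smaller graph avoids the edge made by the suppression. Hence 0 and 1 may be
-- matched by either edge of the digon, and at least one of the two is not at port `k`.
petersen-digon : Petersen n → ∀ (G : DartGraph (2 + n) 3) → NoCutEdge G →
                 Inner G 0F → Inner G 1F → ∀ k → Avoidable G (0F , k)
petersen-digon {n} ih G nce in₀ in₁ k = by (rungs₁ G 2F inners 2F)
  where
  inners : ∀ k → k ≢ 2F → Inner G k
  inners 0F _   = in₀
  inners 1F _   = in₁
  inners 2F 2≢2 = contradiction refl 2≢2

  G′ = suppress G 2F inners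

  k₀ : Fin 3
  k₀ with k ≟ 0F
  ... | yes _ = 1F
  ... | no _  = 0F

  k₀≢k : k₀ ≢ k
  k₀≢k with k ≟ 0F
  ... | yes refl = λ ()
  ... | no k≢0   = k≢0 ∘ sym

  k₀≢2 : k₀ ≢ 2F
  k₀≢2 with k ≟ 0F
  ... | yes _ = λ ()
  ... | no _  = λ ()

  conclude : (M : PerfectMatching G′) → (∀ {a} → mate G (0F , 2F) ≡ keep a → ¬ Matched M a) → Avoidable G (0F , k)
  conclude M avoids with matching-splice G (rungs₁ G 2F inners) M k₀ fits
    where
    fits : ∀ k {a} → mate G (0F , k) ≡ keep a → (Matched M a → k₀ ≡ k) × (k₀ ≡ k → Matched M a)
    fits k ma with refl ← outer-port G 2F inners ma (inj₁ refl) =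
      (λ m → contradiction m (avoids ma)) , (λ eq → contradiction eq k₀≢2)
  ... | M′ , eq = M′ , λ m → k₀≢k (trans (sym eq) m)

  nce′ = noCutEdge-suppress G 2F inners nce

  by : Inner G 2F ⊎ Outer G 2F → Avoidable G (0F , k)
  by (inj₁ in₂) = conclude (petersen-matching ih G′ nce′) λ ma → contradiction (trans (sym in₂) ma) λ ()
  by (inj₂ ((a , ma) , _)) with ih G′ nce′ a
  ... | M , avoids = conclude M λ ma′ m → avoids (subst (Matched M) (keep-injective (trans (sym ma′) ma)) m)

-- The matching avoids the new edge at `a₁`, so port 1 stays free. If the other new edge is matched,
-- 0 and 1 both leave at port 2; otherwise they are matched to each other at port 0. In the swapped
-- graph the same argument applies, as the swap fixes the ports of vertex 0.
petersen-frink : Petersen n → ∀ (G : DartGraph (2 + n) 3) → NoCutEdge G → Frink G → Avoidable G (0F , 1F)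
petersen-frink {n} ih G nce F = [ conclude G F , matching-relabel G swap-ports (0F , 1F) ∘ conclude _ (frink-swap G F) ]′
    (frink-reduction G F nce)
  where
  conclude : ∀ (G : DartGraph (2 + n) 3) (F : Frink G) → NoCutEdge (splice G (rungs F)) → Avoidable G (0F , 1F)
  conclude G F nce′ with ih _ nce′ (a₁ F)
  ... | M , avoids = by (choice M (vertex (a₂ F)) ≟ port (a₂ F))
    where
    Fits : Fin 3 → Set
    Fits k₀ = ∀ k {a} → mate G (0F , k) ≡ keep a → (Matched M a → k₀ ≡ k) × (k₀ ≡ k → Matched M a)

    avoids₁ : ∀ {a} → mate G (0F , 1F) ≡ keep a → ¬ Matched M a
    avoids₁ ma m = avoids (subst (Matched M) (keep-injective (trans (sym ma) (ma₁ F))) m)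

    by : Dec (Matched M (a₂ F)) → Avoidable G (0F , 1F)
    by (yes m₂) with matching-splice G (rungs F) M 2F fits
      where
      fits : Fits 2F
      fits 0F ma = contradiction (trans (sym (inner F)) ma) λ ()
      fits 1F ma = (λ m → contradiction m (avoids₁ ma)) , λ ()
      fits 2F ma = (λ _ → refl) , λ _ → subst (Matched M) (keep-injective (trans (sym (ma₂ F)) ma)) m₂
    ... | M′ , eq = M′ , λ m → contradiction (trans (sym eq) m) λ ()
    by (no ¬m₂) with matching-splice G (rungs F) M 0F fits
      where
      fits : Fits 0F
      fits 0F ma = contradiction (trans (sym (inner F)) ma) λ ()
      fits 1F ma = (λ m → contradiction m (avoids₁ ma)) , λ ()
      fits 2F ma = (λ m → contradiction (subst (Matched M) (keep-injective (trans (sym ma) (ma₂ F))) m) ¬m₂) , λ ()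
    ... | M′ , eq = M′ , λ m → contradiction (trans (sym eq) m) λ ()

-- Frink's configuration needs four spokes. A loop is excluded by `no-loop`, and a second edge
-- between 0 and 1 gives a digon instead.
petersen-inner : Petersen n → ∀ (G : DartGraph (2 + n) 3) → NoCutEdge G → Inner G 0F → Avoidable G (0F , 1F)
petersen-inner {n} ih G nce in₀ = by _ _ refl refl
  where
  parallel : ∀ k {j} → mate G (0F , k) ≡ (1F , j) → 0F ≢ k → ∀ l → Avoidable G (0F , l)
  parallel k {j} eq 0≢k l
    with perm₂ 0≢k
       | perm₂ {u = 0F} {j} (λ { refl → 0≢k (cong port (mate-injective G (trans in₀ (sym eq)))) })
  ... | σ , σ0 , σ1 | τ , τ0 , τ1 with relabelling₂ {n} {u = 0F} {1F} (λ ()) σ τ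
  ... | R , R0 , R1 = subst (Avoidable G) (trans (R0 (σ ⟨$⟩ˡ l)) (cong (0F ,_) (inverseʳ σ)))
    (matching-relabel G R (0F , (σ ⟨$⟩ˡ l)) (petersen-digon ih (relabel G R) (noCutEdge-relabel G R nce)
      (relabel-mate G R (trans (cong (mate G) (trans (R0 0F) (cong (0F ,_) σ0)))
        (trans in₀ (sym (trans (R1 0F) (cong (1F ,_) τ0))))))
      (relabel-mate G R (trans (cong (mate G) (trans (R0 1F) (cong (0F ,_) σ1)))
        (trans eq (sym (trans (R1 1F) (cong (1F ,_) τ1))))))
      (σ ⟨$⟩ˡ l)))

  free : ∀ {v x} → mate G v ≡ x → vertex x ≢ vertex v
  free refl = no-loop G nce _

  outer₁ : ∀ k {a} → 0F ≢ k → mate G (0F , 1F) ≡ keep a → mate G (0F , 2F) ≢ (1F , k) →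
           ∃[ b ] mate G (1F , k) ≡ keep b
  outer₁ k 0≢k ma ¬mb with mate G (1F , k) in eq
  ... | suc (suc v) , j = (v , j) , refl
  ... | 1F , j = contradiction refl (free eq)
  ... | 0F , 0F = contradiction (cong port (trans (sym in₀) (mate-swap G eq))) 0≢k
  ... | 0F , 1F with () ← trans (sym ma) (mate-swap G eq)
  ... | 0F , 2F = contradiction (mate-swap G eq) ¬mb

  by : ∀ x y → mate G (0F , 1F) ≡ x → mate G (0F , 2F) ≡ y → Avoidable G (0F , 1F)
  by (0F , _) _        eq _  = contradiction refl (free eq)
  by (1F , _) _        eq _  = parallel 1F eq (λ ()) 1F
  by _        (0F , _) _  eq = contradiction refl (free eq)
  by _        (1F , _) _  eq = parallel 2F eq (λ ()) 1F
  by (suc (suc v) , k) (suc (suc w) , l) eq₁ eq₂ = petersen-frink ih G nce record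
    { inner = in₀
    ; ma₁   = eq₁
    ; ma₂   = eq₂
    ; mb₁   = proj₂ (outer₁ 1F (λ ()) eq₁ λ p → contradiction (trans (sym eq₂) p) λ ())
    ; mb₂   = proj₂ (outer₁ 2F (λ ()) eq₁ λ p → contradiction (trans (sym eq₂) p) λ ())
    }

another-port : ∀ (k : Fin 3) → ∃[ l ] l ≢ k
another-port 0F      = 1F , λ ()
another-port (suc k) = 0F , λ ()

-- The vertices removed are the ends of another edge at `u`, the one at port `l`. The dart to be
-- avoided thereby becomes port 1 of vertex 0, a spoke or one side of a digon.
petersen : ∀ n → Petersen n
petersen (suc zero) G nce x with mate G x in eq
petersen (suc zero) G nce (0F , _) | 0F , _ = contradiction (cong vertex eq) (no-loop G nce _)
petersen (suc (suc n)) G nce (u , k) with another-port k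
... | l , l≢k with perm₂ l≢k
... | σ , σ0 , σ1 with relabelling₂ (no-loop G nce (u , l) ∘ sym) σ (transpose zero (port (mate G (u , l))))
... | R , R0 , R1 = subst (Avoidable G) (trans (R0 1F) (cong (u ,_) σ1))
  (matching-relabel G R (0F , 1F) (petersen-inner (petersen n) (relabel G R) (noCutEdge-relabel G R nce)
    (relabel-mate G R (trans (cong (mate G) (trans (R0 0F) (cong (u ,_) σ0))) (sym (R1 0F))))))

abstract
  relabelling₃ : {u v w : Fin (3 + n)} → u ≢ v → u ≢ w → v ≢ w → (ρ₀ ρ₁ ρ₂ : Permutation d d) →
    Σ[ R ∈ Relabelling (3 + n) d ] ((∀ k → to R (0F , k) ≡ (u , ρ₀ ⟨$⟩ʳ k)) × (∀ k → to R (1F , k) ≡ (v , ρ₁ ⟨$⟩ʳ k)) ×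
            (∀ k → to R (2F , k) ≡ (w , ρ₂ ⟨$⟩ʳ k)))
  relabelling₃ {n = n} {d = d} u≢v u≢w v≢w ρ₀ ρ₁ ρ₂ with perm₃ u≢v u≢w v≢w
  ... | π , π0 , π1 , π2 = record { π = π ; ρ = ports } ,
    (λ k → cong (_, _) π0) , (λ k → cong (_, _) π1) , (λ k → cong (_, _) π2)
    where
    ports : Fin (3 + n) → Permutation d d
    ports 0F                  = ρ₀
    ports 1F                  = ρ₁
    ports 2F                  = ρ₂
    ports (suc (suc (suc _))) = Perm.id

-- The complement of a perfect matching

module _ (G : DartGraph n 3) (matched : ∀ v → port (mate G (v , 0F)) ≡ 0F) where

  private
    raise : Dart n 2 → Dart n 3
    raise (v , k) = v , suc k

    raise-injective : ∀ {x y} → raise x ≡ raise y → x ≡ y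
    raise-injective refl = refl

    rest : ∀ x → ∃[ y ] mate G (raise x) ≡ raise y
    rest (v , k) with mate G (v , suc k) in eq
    ... | w , suc l = (w , l) , refl
    ... | w , 0F with () ← trans (sym (cong port (mate-swap G eq))) (matched w)

  twoFactor : DartGraph n 2
  mate twoFactor x = proj₁ (rest x)
  mate-involutive twoFactor x = raise-injective
    (trans (sym (proj₂ (rest (proj₁ (rest x))))) (mate-swap G (proj₂ (rest x))))
  mate-irrefl twoFactor x eq = mate-irrefl G (raise x) (trans (proj₂ (rest x)) (cong raise eq))

  -- Only odd cycles cost a conflict. Of the odd lengths below 5, length 1 contradicts the absence
  -- of cut edges and length 3 the absence of triangles.
  longCycles-twoFactor : NoCutEdge G → (∀ x y z → ¬ Triangle G x y z) → LongCycles twoFactor (λ _ → 1)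
  positive (longCycles-twoFactor nce free) v = s≤s z≤n
  loop     (longCycles-twoFactor nce free) x l =
    contradiction (trans (cong vertex (proj₂ (rest x))) l) (no-loop G nce (raise x))
  triangle (longCycles-twoFactor nce free) x y z t = contradiction record
    { xy = trans (xy t) (sym (cong vertex (proj₂ (rest x))))
    ; yz = trans (yz t) (sym (cong vertex (proj₂ (rest y))))
    ; zx = trans (zx t) (sym (cong vertex (proj₂ (rest z))))
    } (free (raise x) (raise y) (raise z))

  colouring-twoFactor : ∀ c → ∃[ c′ ] conflicts G c′ ≡ conflicts twoFactor c
  colouring-twoFactor c = c′ , sum-cong-≗ λ v → cong₂ _+_ (matching-edge v) (sum-cong-≗ λ k → cycle-edge (v , k))
    where
    c′ : Colouring n 3
    colour c′ (v , 0F)    = 0F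
    colour c′ (v , suc k) = suc (colour c (v , k))
    proper c′ {v} {0F}    {0F}    eq = refl
    proper c′ {v} {suc k} {suc l} eq = cong suc (proper c (suc-injective eq))

    matching-edge : ∀ v → conflict G c′ (v , 0F) ≡ 0
    matching-edge v with mate G (v , 0F) | matched v
    ... | w , .0F | refl = refl

    cycle-edge : ∀ x → conflict G c′ (raise x) ≡ conflict twoFactor c x
    cycle-edge x = cong (differ (suc (colour c x)) ∘ colour c′) (proj₂ (rest x))

align-matching : ∀ (G : DartGraph n 3) → PerfectMatching G → Relabelling n 3
align-matching G M = record { π = Perm.id ; ρ = λ v → transpose 0F (choice M v) }

align-matched : ∀ (G : DartGraph n 3) M v → port (mate (relabel G (align-matching G M)) (v , 0F)) ≡ 0F
align-matched G M v = trans
  (cong (transpose 0F (choice M w) ⟨$⟩ˡ_)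
    (sym (trans (transpose-at 0F (choice M w)) (closed M y (sym (transpose-at 0F (choice M v)))))))
  (inverseˡ (transpose 0F (choice M w)))
  where
  y = to (align-matching G M) (v , 0F)
  w = vertex (mate G y)

aligned-fewConflicts : ∀ (G : DartGraph n 3) → (∀ v → port (mate G (v , 0F)) ≡ 0F) → NoCutEdge G →
                       (∀ x y z → ¬ Triangle G x y z) → FewConflicts 5 G (λ _ → 1)
aligned-fewConflicts {n} G matched nce free =
  fewConflicts-transfer G (twoFactor G matched) _ _ (colouring-twoFactor G matched) ≤-refl
    (twoRegular-fewConflicts n (twoFactor G matched) (λ _ → 1) (longCycles-twoFactor G matched nce free))

triangleFree-fewConflicts : ∀ (G : DartGraph n 3) → NoCutEdge G → (∀ x y z → ¬ Triangle G x y z) →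
                            FewConflicts 5 G (λ _ → 1)
triangleFree-fewConflicts {n} G nce free = fewConflicts-relabel G R (λ _ → 1)
  (aligned-fewConflicts (relabel G R) (align-matched G M) (noCutEdge-relabel G R nce)
    λ x y z t → free _ _ _ (triangle-relabel G R t))
  where
  M = petersen-matching (petersen n) G nce
  R = align-matching G M

-- Contraction of a triangle

module _ (G : DartGraph (3 + n) 3)
  (t₀ : mate G (0F , 0F) ≡ (1F , 1F)) (t₁ : mate G (1F , 0F) ≡ (2F , 1F)) (t₂ : mate G (2F , 0F) ≡ (0F , 1F)) where

  -- The dart k at the contracted vertex 0 is the dart of the corner k that leaves the triangle.
  expand : Dart (1 + n) 3 → Dart (3 + n) 3
  expand (0F , 0F)    = 0F , 2F
  expand (0F , 1F)    = 1F , 2F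
  expand (0F , 2F)    = 2F , 2F
  expand (suc v , k)  = suc (suc (suc v)) , k

  collapse : Fin (3 + n) → Fin (1 + n)
  collapse 0F                  = 0F
  collapse 1F                  = 0F
  collapse 2F                  = 0F
  collapse (suc (suc (suc v))) = suc v

  collapse-expand : ∀ x → collapse (vertex (expand x)) ≡ vertex x
  collapse-expand (0F , 0F)   = refl
  collapse-expand (0F , 1F)   = refl
  collapse-expand (0F , 2F)   = refl
  collapse-expand (suc v , k) = refl

  expand-injective : ∀ {x y} → expand x ≡ expand y → x ≡ y
  expand-injective {0F , 0F}   {0F , 0F}    _    = refl
  expand-injective {0F , 1F}   {0F , 1F}    _    = refl
  expand-injective {0F , 2F}   {0F , 2F}    _    = refl
  expand-injective {suc v , k} {suc .v , .k} refl = refl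
  expand-injective {0F , 0F}   {0F , 1F}    ()
  expand-injective {0F , 0F}   {0F , 2F}    ()
  expand-injective {0F , 1F}   {0F , 0F}    ()
  expand-injective {0F , 1F}   {0F , 2F}    ()
  expand-injective {0F , 2F}   {0F , 0F}    ()
  expand-injective {0F , 2F}   {0F , 1F}    ()
  expand-injective {suc _ , _} {0F , 0F}    ()
  expand-injective {suc _ , _} {0F , 1F}    ()
  expand-injective {suc _ , _} {0F , 2F}    ()
  expand-injective {0F , 0F}   {suc _ , _}  ()
  expand-injective {0F , 1F}   {suc _ , _}  ()
  expand-injective {0F , 2F}   {suc _ , _}  ()

  data Side : Dart (3 + n) 3 → Set where
    side₀  : Side (0F , 0F)
    side₀′ : Side (1F , 1F)
    side₁  : Side (1F , 0F)
    side₁′ : Side (2F , 1F)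
    side₂  : Side (2F , 0F)
    side₂′ : Side (0F , 1F)

  side-mate : ∀ {y} → Side y → Side (mate G y)
  side-mate side₀  = subst Side (sym t₀) side₀′
  side-mate side₀′ = subst Side (sym (mate-swap G t₀)) side₀
  side-mate side₁  = subst Side (sym t₁) side₁′
  side-mate side₁′ = subst Side (sym (mate-swap G t₁)) side₁
  side-mate side₂  = subst Side (sym t₂) side₂′
  side-mate side₂′ = subst Side (sym (mate-swap G t₂)) side₂

  side-collapse : ∀ {y} → Side y → collapse (vertex y) ≡ 0F
  side-collapse side₀  = refl
  side-collapse side₀′ = refl
  side-collapse side₁  = refl
  side-collapse side₁′ = refl
  side-collapse side₂  = refl
  side-collapse side₂′ = refl

  expand-not-side : ∀ {y} x → y ≡ expand x → ¬ Side y
  expand-not-side (0F , 0F)   refl ()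
  expand-not-side (0F , 1F)   refl ()
  expand-not-side (0F , 2F)   refl ()
  expand-not-side (suc v , k) refl ()

  locate : ∀ y → Side y ⊎ ∃[ x ] y ≡ expand x
  locate (0F , 0F) = inj₁ side₀
  locate (0F , 1F) = inj₁ side₂′
  locate (0F , 2F) = inj₂ ((0F , 0F) , refl)
  locate (1F , 0F) = inj₁ side₁
  locate (1F , 1F) = inj₁ side₀′
  locate (1F , 2F) = inj₂ ((0F , 1F) , refl)
  locate (2F , 0F) = inj₁ side₂
  locate (2F , 1F) = inj₁ side₁′
  locate (2F , 2F) = inj₂ ((0F , 2F) , refl)
  locate (suc (suc (suc v)) , k) = inj₂ ((suc v , k) , refl)

  private
    outer : ∀ x → ∃[ y ] mate G (expand x) ≡ expand y
    outer x with locate (mate G (expand x))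
    ... | inj₂ found = found
    ... | inj₁ side  = contradiction (side-mate side) (expand-not-side x (mate-involutive G _))

  abstract
    contract : DartGraph (1 + n) 3
    mate contract x = proj₁ (outer x)
    mate-involutive contract x = expand-injective
      (trans (sym (proj₂ (outer (proj₁ (outer x))))) (mate-swap G (proj₂ (outer x))))
    mate-irrefl contract x eq = mate-irrefl G (expand x) (trans (proj₂ (outer x)) (cong expand eq))

    mate-expand : ∀ x → mate G (expand x) ≡ expand (mate contract x)
    mate-expand x = proj₂ (outer x)

  vertex-contract : ∀ x → vertex (mate contract x) ≡ collapse (vertex (mate G (expand x)))
  vertex-contract x = trans (sym (collapse-expand _)) (cong (collapse ∘ vertex) (sym (mate-expand x)))

  -- A vertex set is pulled back along `collapse`. The three corners fall on one side, so no side of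
  -- the triangle crosses, and all other edges correspond one to one.
  noCutEdge-contract : NoCutEdge G → NoCutEdge contract
  noCutEdge-contract nce S x ce = nce (S ∘ collapse) (expand x)
    (cutEdge-transfer G contract (λ y z → y ≡ expand z)
      (λ { {z = z} refl → mate-expand z })
      (λ p q → trans p (sym q))
      image refl (crosses-expand x (crosses ce)) ce)
    where
    crosses-expand : ∀ z → Crosses contract S z → Crosses G (S ∘ collapse) (expand z)
    crosses-expand z cr eq = cr (trans (cong S (sym (collapse-expand z)))
      (trans eq (cong S (sym (vertex-contract z)))))

    image : ∀ y → Crosses G (S ∘ collapse) y → ∃[ z ] (y ≡ expand z × Crosses contract S z)
    image y cr with locate y
    ... | inj₁ side = contradiction (cong S (trans (side-collapse side) (sym (side-collapse (side-mate side))))) cr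
    ... | inj₂ (z , refl) = z , refl , λ eq → cr (trans (cong S (collapse-expand z))
      (trans eq (cong S (vertex-contract z))))

  -- An edge of the triangle gets the colour of the edge leaving the opposite corner.
  colouring-contract : ∀ c → ∃[ c′ ] conflicts G c′ ≡ conflicts contract c
  colouring-contract c = c′ , total
    where
    c′ : Colouring (3 + n) 3
    colour c′ (0F , k)                  = colour c (0F , transpose 0F 2F ⟨$⟩ʳ k)
    colour c′ (1F , k)                  = colour c (0F , transpose 1F 2F ⟨$⟩ʳ k)
    colour c′ (2F , k)                  = colour c (0F , transpose 0F 1F ⟨$⟩ʳ k)
    colour c′ (suc (suc (suc v)) , k)   = colour c (suc v , k)
    proper c′ {0F}                eq    = perm-inj (transpose 0F 2F) (proper c eq)
    proper c′ {1F}                eq    = perm-inj (transpose 1F 2F) (proper c eq)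
    proper c′ {2F}                eq    = perm-inj (transpose 0F 1F) (proper c eq)
    proper c′ {suc (suc (suc v))} eq    = proper c eq

    colour-expand : ∀ x → colour c′ (expand x) ≡ colour c x
    colour-expand (0F , 0F)   = refl
    colour-expand (0F , 1F)   = refl
    colour-expand (0F , 2F)   = refl
    colour-expand (suc v , k) = refl

    f = conflict G c′
    g = conflict contract c

    on-outer : ∀ x → f (expand x) ≡ g x
    on-outer x = cong₂ differ (colour-expand x) (trans (cong (colour c′) (mate-expand x)) (colour-expand _))

    on-side : ∀ {y z} → mate G y ≡ z → colour c′ y ≡ colour c′ z → f y ≡ 0
    on-side {y} p eq = trans (cong (differ (colour c′ y)) (trans (cong (colour c′) p) (sym eq)))
      (differ-refl (colour c′ y))

    corner-sum : ∀ {a b e r} → a ≡ 0 → b ≡ 0 → e ≡ r → a + (b + (e + 0)) ≡ r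
    corner-sum refl refl refl = +-identityʳ _

    total : conflicts G c′ ≡ conflicts contract c
    total = trans
      (cong₂ _+_ (corner-sum (on-side t₀ refl) (on-side (mate-swap G t₂) refl) (on-outer (0F , 0F)))
        (cong₂ _+_ (corner-sum (on-side t₁ refl) (on-side (mate-swap G t₀) refl) (on-outer (0F , 1F)))
          (cong₂ _+_ (corner-sum (on-side t₂ refl) (on-side (mate-swap G t₁) refl) (on-outer (0F , 2F)))
            (sumᴰ-cong {n} {3} λ { (v , k) → on-outer (suc v , k) }))))
      (regroup (g (0F , 0F)) (g (0F , 1F)) (g (0F , 2F)) _)
      where
      regroup : ∀ a b e r → a + (b + (e + r)) ≡ a + (b + (e + 0)) + r
      regroup a b e r = sym (trans (cong (λ i → a + (b + i) + r) (+-identityʳ e))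
        (trans (+-assoc a (b + e) r) (cong (a +_) (+-assoc b e r))))

-- Digons and triangles

record Digon (G : DartGraph n d) (x y : Dart n d) : Set where
  field
    distinct : x ≢ y
    from-one : vertex x ≡ vertex y
    into-one : vertex (mate G x) ≡ vertex (mate G y)

open Digon

digon? : ∀ (G : DartGraph n d) x y → Dec (Digon G x y)
digon? G x y = map′ (λ (p , q , r) → record { distinct = p ; from-one = q ; into-one = r })
  (λ t → distinct t , from-one t , into-one t)
  (¬? (x ≟ᴰ y) ×-dec (vertex x ≟ vertex y) ×-dec (vertex (mate G x) ≟ vertex (mate G y)))

triangle? : ∀ (G : DartGraph n d) x y z → Dec (Triangle G x y z)
triangle? G x y z = map′ (λ (p , q , r) → record { xy = p ; yz = q ; zx = r })
  (λ t → xy t , yz t , zx t)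
  ((vertex y ≟ vertex (mate G x)) ×-dec (vertex z ≟ vertex (mate G y)) ×-dec (vertex x ≟ vertex (mate G z)))

anyDart? : {P : Dart n d → Set} → (∀ x → Dec (P x)) → Dec (∃[ x ] P x)
anyDart? P? = map′ (λ (v , k , p) → (v , k) , p) (λ ((v , k) , p) → v , k , p)
  (any? λ v → any? λ k → P? (v , k))

InDigon InTriangle : DartGraph n d → Fin n → Set
InDigon    G v = ∃[ x ] ∃[ y ] (Digon G x y × vertex x ≡ v)
InTriangle G v = ∃[ x ] ∃[ y ] ∃[ z ] (Triangle G x y z × vertex x ≡ v)

-- The weight of a vertex is the number of original vertices contracted into it.
Covered : DartGraph n d → (Fin n → ℕ) → Fin n → Set
Covered G w v = 3 ≤ w v ⊎ InDigon G v ⊎ InTriangle G v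

from-mate : ∀ (G : DartGraph n d) R x → mate (relabel G R) (from R x) ≡ from R (mate G x)
from-mate G R x = cong (from R ∘ mate G) (to-from R x)

covered-relabel : ∀ (G : DartGraph n d) R w v → Covered G w (π R ⟨$⟩ʳ v) → Covered (relabel G R) (w ∘ (π R ⟨$⟩ʳ_)) v
covered-relabel G R w v (inj₁ heavy) = inj₁ heavy
covered-relabel G R w v (inj₂ (inj₁ (x , y , t , x∈v))) = inj₂ (inj₁ (from R x , from R y , record
  { distinct = λ eq → distinct t (trans (sym (to-from R x)) (trans (cong (to R) eq) (to-from R y)))
  ; from-one = cong (π R ⟨$⟩ˡ_) (from-one t)
  ; into-one = trans (cong vertex (from-mate G R x))
      (trans (cong (π R ⟨$⟩ˡ_) (into-one t)) (sym (cong vertex (from-mate G R y))))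
  } , trans (cong (π R ⟨$⟩ˡ_) x∈v) (inverseˡ (π R))))
covered-relabel G R w v (inj₂ (inj₂ (x , y , z , t , x∈v))) = inj₂ (inj₂ (from R x , from R y , from R z , record
  { xy = trans (cong (π R ⟨$⟩ˡ_) (xy t)) (sym (cong vertex (from-mate G R x)))
  ; yz = trans (cong (π R ⟨$⟩ˡ_) (yz t)) (sym (cong vertex (from-mate G R y)))
  ; zx = trans (cong (π R ⟨$⟩ˡ_) (zx t)) (sym (cong vertex (from-mate G R z)))
  } , trans (cong (π R ⟨$⟩ˡ_) x∈v) (inverseˡ (π R))))

module _ (G : DartGraph (2 + n) 3) (nce : NoCutEdge G) (inner : ∀ k → k ≢ 2F → Inner G k) where

  private
    G′ = suppress G 2F inner

    no-loop′ : ∀ x → vertex (mate G′ x) ≢ vertex x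
    no-loop′ = no-loop G′ (noCutEdge-suppress G 2F inner nce)

    data Place : Dart (2 + n) 3 → Set where
      kept : ∀ x → Place (keep x)
      at₀  : ∀ k → Place (0F , k)
      at₁  : ∀ k → Place (1F , k)

    place : ∀ y → Place y
    place (0F , k)            = at₀ k
    place (1F , k)            = at₁ k
    place (suc (suc v) , k)   = kept (v , k)

    kept-mate : ∀ {x y} → mate G (keep x) ≡ keep y → mate G′ x ≡ y
    kept-mate p = mate-splice G (rungs₁ G 2F inner) (direct p)

    exit₀ : ∀ {k x} → mate G (0F , k) ≡ keep x → k ≡ 2F
    exit₀ p = outer-port G 2F inner p (inj₁ refl)

    exit₁ : ∀ {k x} → mate G (1F , k) ≡ keep x → k ≡ 2F
    exit₁ p = outer-port G 2F inner p (inj₂ refl)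

    exits : ∀ {x y} → mate G (0F , 2F) ≡ keep x → mate G (1F , 2F) ≡ keep y → mate G′ x ≡ y
    exits p q = mate-splice G (rungs₁ G 2F inner) (via₀ 2F p q)

    -- Each removed vertex has a single dart that can lead to a surviving vertex, so a digon at a
    -- surviving vertex cannot end in 0 or 1.
    inDigon : ∀ v → InDigon G (suc (suc v)) → InDigon G′ v
    inDigon v ((.(suc (suc v)) , k) , y , t , refl) with place y
    ... | at₀ l with () ← from-one t
    ... | at₁ l with () ← from-one t
    ... | kept (u , l) with refl ← from-one t = by (place _) refl (place _) refl (into-one t)
      where
      by : ∀ {x′ y′} → Place x′ → mate G (keep (v , k)) ≡ x′ → Place y′ → mate G (keep (v , l)) ≡ y′ →
           vertex x′ ≡ vertex y′ → InDigon G′ v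
      by (kept a) ma (kept b) mb eq = (v , k) , (v , l) , record
        { distinct = λ { refl → distinct t refl }
        ; from-one = refl
        ; into-one = trans (cong vertex (kept-mate ma)) (trans (vertex-eq eq) (sym (cong vertex (kept-mate mb))))
        } , refl
        where
        vertex-eq : ∀ {i j : Fin n} → _≡_ {A = Fin (2 + n)} (suc (suc i)) (suc (suc j)) → i ≡ j
        vertex-eq refl = refl
      by (at₀ i) ma (at₀ j) mb eq with refl ← exit₀ (mate-swap G ma) | refl ← exit₀ (mate-swap G mb) =
        contradiction (mate-injective G (trans ma (sym mb))) (distinct t)
      by (at₁ i) ma (at₁ j) mb eq with refl ← exit₁ (mate-swap G ma) | refl ← exit₁ (mate-swap G mb) =
        contradiction (mate-injective G (trans ma (sym mb))) (distinct t)
      by (at₀ _) _ (at₁ _) _ ()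
      by (at₁ _) _ (at₀ _) _ ()
      by (at₀ _) _ (kept _) _ ()
      by (at₁ _) _ (kept _) _ ()
      by (kept _) _ (at₀ _) _ ()
      by (kept _) _ (at₁ _) _ ()

    target : ∀ x i → suc (suc i) ≡ vertex (mate G (keep x)) → i ≡ vertex (mate G′ x)
    target x i e with mate G (keep x) in eq
    target x i refl | .(suc (suc i)) , l = sym (cong vertex (kept-mate eq))

    kept-end : ∀ {y} {i : Fin n} → suc (suc i) ≡ vertex (mate G y) → ∃[ b ] (mate G y ≡ keep b × vertex b ≡ i)
    kept-end {y} {i} e with mate G y
    kept-end {y} {i} refl | .(suc (suc i)) , l = (i , l) , refl , refl

    at-end : ∀ {y v} → v ≡ vertex (mate G y) → ∃[ l ] mate G y ≡ (v , l)
    at-end {y} refl = port (mate G y) , refl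

    no-return : ∀ {x y z} → Triangle G x y z → mate G y ≢ z
    no-return {x} {y} t refl = no-loop G nce x (trans (sym (xy t)) (sym (trans (zx t) (cong vertex (mate-involutive G y)))))

    no-return′ : ∀ {x y z} → Triangle G x y z → mate G x ≢ y
    no-return′ {x} {z = z} t refl = no-loop G nce z (trans (sym (zx t)) (sym (trans (yz t) (cong vertex (mate-involutive G x)))))

    -- By the same count, a triangle that meets 0 or 1 and a surviving vertex contains both 0 and 1.
    -- Its suppression would leave a loop at the third vertex, which is impossible in a graph
    -- without cut edges.
    inTriangle : ∀ v → InTriangle G (suc (suc v)) → InTriangle G′ v
    inTriangle v ((.(suc (suc v)) , k) , y , z , t , refl) with place y | place z
    ... | kept y′ | kept z′ = (v , k) , y′ , z′ , record
      { xy = target (v , k) (vertex y′) (xy t)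
      ; yz = target y′ (vertex z′) (yz t)
      ; zx = target z′ v (zx t)
      } , refl
    ... | kept y′ | at₀ l with at-end (yz t) | kept-end (zx t)
    ...   | j , p | b , q , _ with refl ← exit₀ (mate-swap G p) | refl ← exit₀ q = contradiction p (no-return t)
    inTriangle v ((.(suc (suc v)) , k) , y , z , t , refl) | kept y′ | at₁ l with at-end (yz t) | kept-end (zx t)
    ...   | j , p | b , q , _ with refl ← exit₁ (mate-swap G p) | refl ← exit₁ q = contradiction p (no-return t)
    inTriangle v ((.(suc (suc v)) , k) , y , z , t , refl) | at₀ l | _ with at-end (xy t)
    ... | j , p with refl ← exit₀ (mate-swap G p) with l ≟ 2F
    ...   | yes refl = contradiction p (no-return′ t)
    ...   | no l≢2 with refl ← trans (yz t) (cong vertex (inner l l≢2)) with kept-end (zx t)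
    ...     | b , q , b∈v with refl ← exit₁ q =
      contradiction (trans (cong vertex (exits (mate-swap G p) q)) b∈v) (no-loop′ (v , k))
    inTriangle v ((.(suc (suc v)) , k) , y , z , t , refl) | at₁ l | _ with at-end (xy t)
    ... | j , p with refl ← exit₁ (mate-swap G p) with l ≟ 2F
    ...   | yes refl = contradiction p (no-return′ t)
    ...   | no l≢2 with refl ← trans (yz t) (cong vertex (mate-swap G (inner l l≢2))) with kept-end (zx t)
    ...     | b , q , b∈v with refl ← exit₀ q =
      contradiction (trans (cong vertex (exits q (mate-swap G p))) (sym b∈v)) (no-loop′ b)

  covered-suppress : ∀ w v → Covered G w (suc (suc v)) → Covered G′ (λ u → w (suc (suc u))) v
  covered-suppress w v (inj₁ heavy)    = inj₁ heavy
  covered-suppress w v (inj₂ (inj₁ t)) = inj₂ (inj₁ (inDigon v t))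
  covered-suppress w v (inj₂ (inj₂ t)) = inj₂ (inj₂ (inTriangle v t))

module _ (G : DartGraph (3 + n) 3) (nce : NoCutEdge G)
  (t₀ : mate G (0F , 0F) ≡ (1F , 1F)) (t₁ : mate G (1F , 0F) ≡ (2F , 1F)) (t₂ : mate G (2F , 0F) ≡ (0F , 1F)) where

  private
    G′ = contract G t₀ t₁ t₂
    ψ  = expand G t₀ t₁ t₂
    κ  = collapse G t₀ t₁ t₂

    κψ : ∀ {x v} → vertex (ψ x) ≡ v → vertex x ≡ κ v
    κψ {x} e = trans (sym (collapse-expand G t₀ t₁ t₂ x)) (cong κ e)

    κ-mate : ∀ x → vertex (mate G′ x) ≡ κ (vertex (mate G (ψ x)))
    κ-mate = vertex-contract G t₀ t₁ t₂

    outer-at : ∀ {y} {v : Fin n} → vertex y ≡ suc (suc (suc v)) → ∃[ x ] y ≡ ψ x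
    outer-at {.(suc (suc (suc v))) , k} {v} refl = (suc v , k) , refl

    inDigon′ : ∀ v → InDigon G (suc (suc (suc v))) → InDigon G′ (suc v)
    inDigon′ v (x , y , t , x∈v) with outer-at {x} x∈v | outer-at {y} (trans (sym (from-one t)) x∈v)
    ... | x′ , refl | y′ , refl = x′ , y′ , record
      { distinct = λ { refl → distinct t refl }
      ; from-one = trans (κψ {x′} (from-one t)) (collapse-expand G t₀ t₁ t₂ y′)
      ; into-one = trans (κ-mate x′) (trans (cong κ (into-one t)) (sym (κ-mate y′)))
      } , κψ {x′} x∈v

    -- A triangle sharing an edge with the contracted one becomes a digon.
    inTriangle′ : ∀ v → InTriangle G (suc (suc (suc v))) → InDigon G′ (suc v) ⊎ InTriangle G′ (suc v)
    inTriangle′ v (x , y , z , t , x∈v)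
      with outer-at {x} x∈v | outer-at {mate G z} (trans (sym (zx t)) x∈v) | locate G t₀ t₁ t₂ y | locate G t₀ t₁ t₂ z
    ... | x′ , refl | z″ , eqz | inj₂ (y′ , refl) | inj₂ (z′ , refl) = inj₂ (x′ , y′ , z′ , record
      { xy = trans (κψ {y′} (xy t)) (sym (κ-mate x′))
      ; yz = trans (κψ {z′} (yz t)) (sym (κ-mate y′))
      ; zx = trans (κψ {x′} (zx t)) (sym (κ-mate z′))
      } , κψ {x′} x∈v)
    ... | x′ , refl | z″ , eqz | inj₂ _ | inj₁ side =
      contradiction (side-mate G t₀ t₁ t₂ side) (expand-not-side G t₀ t₁ t₂ z″ eqz)
    ... | x′ , refl | z″ , eqz | inj₁ side | _ = inj₁ (x′ , z″ , record
      { distinct = λ { refl → no-loop G nce y (trans (sym (yz t))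
          (trans (cong vertex (sym (mate-swap G eqz))) (sym (xy t)))) }
      ; from-one = trans (κψ {x′} (trans (zx t) (cong vertex eqz))) (collapse-expand G t₀ t₁ t₂ z″)
      ; into-one = trans (trans (κ-mate x′) (trans (cong κ (sym (xy t))) (side-collapse G t₀ t₁ t₂ side)))
          (sym (trans (κ-mate z″) (trans (cong (κ ∘ vertex) (mate-swap G eqz))
            (trans (cong κ (yz t)) (side-collapse G t₀ t₁ t₂ (side-mate G t₀ t₁ t₂ side))))))
      } , κψ {x′} x∈v)

  contract-weight : (Fin (3 + n) → ℕ) → Fin (1 + n) → ℕ
  contract-weight w 0F      = w 0F + (w 1F + w 2F)
  contract-weight w (suc v) = w (suc (suc (suc v)))

  covered-contract : ∀ w → (∀ v → 1 ≤ w v) → (∀ v → Covered G w v) → ∀ v → Covered G′ (contract-weight w) v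
  covered-contract w pos cov 0F = inj₁ (+-mono-≤ (pos 0F) (+-mono-≤ (pos 1F) (pos 2F)))
  covered-contract w pos cov (suc v) with cov (suc (suc (suc v)))
  ... | inj₁ heavy    = inj₁ heavy
  ... | inj₂ (inj₁ t) = inj₂ (inj₁ (inDigon′ v t))
  ... | inj₂ (inj₂ t) = inj₂ (inTriangle′ v t)

-- Induction over digons and triangles

Claim : ℕ → Set
Claim n = ∀ (G : DartGraph n 3) w → NoCutEdge G → (∀ v → 1 ≤ w v) → (∀ v → Covered G w v) → FewConflicts 15 G w

-- No additional conflict is charged to 0 and 1, so their weight may be dropped; the survivors stay
-- covered by `covered-suppress`.
digon-step : ∀ (G : DartGraph (2 + n) 3) → Inner G 0F → Inner G 1F → Claim n →
             ∀ w → NoCutEdge G → (∀ v → 1 ≤ w v) → (∀ v → Covered G w v) → FewConflicts 15 G w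
digon-step {n} G in₀ in₁ ih w nce pos cov =
  fewConflicts-transfer G (suppress G 2F inners) w w′ (colouring-suppress G 2F inners)
    (≤-trans (m≤n+m _ (w 1F)) (m≤n+m _ (w 0F)))
    (ih (suppress G 2F inners) w′ (noCutEdge-suppress G 2F inners nce) (λ v → pos _)
      λ v → covered-suppress G nce inners w v (cov _))
  where
  w′ : Fin n → ℕ
  w′ v = w (suc (suc v))

  inners : ∀ k → k ≢ 2F → Inner G k
  inners 0F _   = in₀
  inners 1F _   = in₁
  inners 2F 2≢2 = contradiction refl 2≢2

triangle-step : ∀ (G : DartGraph (3 + n) 3) →
  mate G (0F , 0F) ≡ (1F , 1F) → mate G (1F , 0F) ≡ (2F , 1F) → mate G (2F , 0F) ≡ (0F , 1F) → Claim (1 + n) →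
  ∀ w → NoCutEdge G → (∀ v → 1 ≤ w v) → (∀ v → Covered G w v) → FewConflicts 15 G w
triangle-step {n} G t₀ t₁ t₂ ih w nce pos cov =
  fewConflicts-transfer G G′ w w′ (colouring-contract G t₀ t₁ t₂) (≤-reflexive total)
    (ih G′ w′ (noCutEdge-contract G t₀ t₁ t₂ nce) pos′ (covered-contract G nce t₀ t₁ t₂ w pos cov))
  where
  G′ = contract G t₀ t₁ t₂
  w′ = contract-weight G nce t₀ t₁ t₂ w

  pos′ : ∀ v → 1 ≤ w′ v
  pos′ 0F      = ≤-trans (pos 0F) (m≤m+n _ _)
  pos′ (suc v) = pos _

  total : sum w′ ≡ sum w
  total = trans (+-assoc (w 0F) _ _) (cong (w 0F +_) (+-assoc (w 1F) (w 2F) _))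

sum-3≤ : ∀ (w : Fin n → ℕ) → (∀ v → 3 ≤ w v) → 3 * sum {n} (λ _ → 1) ≤ sum w
sum-3≤ {zero}  w heavy = z≤n
sum-3≤ {suc n} w heavy = ≤-trans (≤-reflexive (*-distribˡ-+ 3 1 (sum {n} (λ _ → 1))))
  (+-mono-≤ (heavy zero) (sum-3≤ (w ∘ suc) (heavy ∘ suc)))

-- Here 15 arises as 3 times 5: the odd cycles have length at least 5, and each vertex on them
-- weighs at least 3.
free-step : ∀ (G : DartGraph n 3) w → NoCutEdge G → (∀ v → 3 ≤ w v) → (∀ x y z → ¬ Triangle G x y z) →
            FewConflicts 15 G w
free-step {n} G w nce heavy free = scale (triangleFree-fewConflicts G nce free)
  where
  open FewConflicts

  scale : FewConflicts 5 G (λ _ → 1) → FewConflicts 15 G w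
  scale few = record
    { colouring = colouring few
    ; bound     = begin
        15 * conflicts G (colouring few)       ≡⟨ *-assoc 3 5 (conflicts G (colouring few)) ⟩
        3 * (5 * conflicts G (colouring few))  ≤⟨ *-monoʳ-≤ 3 (bound few) ⟩
        3 * (2 * sum {n} (λ _ → 1))            ≡⟨ swap-factors (sum {n} (λ _ → 1)) ⟩
        2 * (3 * sum {n} (λ _ → 1))            ≤⟨ *-monoʳ-≤ 2 (sum-3≤ w heavy) ⟩
        2 * sum w                              ∎
    }
    where
    open ≤-Reasoning
    swap-factors : ∀ s → 3 * (2 * s) ≡ 2 * (3 * s)
    swap-factors s = trans (sym (*-assoc 3 2 s)) (*-assoc 2 3 s)

relabel-step : ∀ (G : DartGraph n 3) R →
  (∀ w → NoCutEdge (relabel G R) → (∀ v → 1 ≤ w v) → (∀ v → Covered (relabel G R) w v) →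
    FewConflicts 15 (relabel G R) w) →
  ∀ w → NoCutEdge G → (∀ v → 1 ≤ w v) → (∀ v → Covered G w v) → FewConflicts 15 G w
relabel-step G R claim w nce pos cov = fewConflicts-relabel G R w
  (claim _ (noCutEdge-relabel G R nce) (λ v → pos _) λ v → covered-relabel G R w v (cov _))

relabelled-mate : ∀ (G : DartGraph n d) R {x y : Dart n d} {k l : Fin d} {σ τ : Permutation d d} {u v} →
  (∀ j → to R (u , j) ≡ (vertex x , σ ⟨$⟩ʳ j)) → σ ⟨$⟩ʳ k ≡ port x →
  (∀ j → to R (v , j) ≡ (vertex y , τ ⟨$⟩ʳ j)) → τ ⟨$⟩ʳ l ≡ port y →
  mate G x ≡ y → mate (relabel G R) (u , k) ≡ (v , l)
relabelled-mate G R Ru σk Rv τl eq = relabel-mate G R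
  (trans (cong (mate G) (trans (Ru _) (cong (_ ,_) σk))) (trans eq (sym (trans (Rv _) (cong (_ ,_) τl)))))

digon-case : ∀ (G : DartGraph n 3) → (∀ {m} → m < n → Claim m) → ∀ {x y} → Digon G x y →
             ∀ w → NoCutEdge G → (∀ v → 1 ≤ w v) → (∀ v → Covered G w v) → FewConflicts 15 G w
digon-case {suc zero} G ih {x} t w nce with vertex x | vertex (mate G x) | no-loop G nce x
... | 0F | 0F | ne = contradiction refl ne
digon-case {suc (suc n)} G ih {u , k} {.u , l} record { distinct = x≢y ; from-one = refl ; into-one = v≡v } w nce
  with mate G (u , k) in eqx | mate G (u , l) in eqy
digon-case {suc (suc n)} G ih {u , k} {.u , l} record { distinct = x≢y ; from-one = refl ; into-one = refl } w nce
  | v , i | .v , j with perm₂ {u = k} {l} (x≢y ∘ cong (u ,_)) | perm₂ {u = i} {j} i≢j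
  where
  i≢j : i ≢ j
  i≢j refl = x≢y (mate-injective G (trans eqx (sym eqy)))
... | σ , σ0 , σ1 | τ , τ0 , τ1
  with relabelling₂ {u = u} {v} (λ { refl → no-loop G nce (u , k) (cong vertex eqx) }) σ τ
... | R , R0 , R1 = relabel-step G R (digon-step (relabel G R)
    (relabelled-mate G R {x = u , k} {v , i} {σ = σ} {τ} R0 σ0 R1 τ0 eqx)
    (relabelled-mate G R {x = u , l} {v , j} {σ = σ} {τ} R0 σ1 R1 τ1 eqy)
    (ih (m<n⇒m<1+n (n<1+n n)))) w nce

three-distinct : ∀ {u v w : Fin n} → u ≢ v → u ≢ w → v ≢ w → ∃[ m ] n ≡ 3 + m
three-distinct {suc zero} {0F} {0F} u≢v _ _ = contradiction refl u≢v
three-distinct {suc (suc zero)} {0F} {0F} u≢v _ _ = contradiction refl u≢v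
three-distinct {suc (suc zero)} {1F} {1F} u≢v _ _ = contradiction refl u≢v
three-distinct {suc (suc zero)} {0F} {1F} {0F} _ u≢w _ = contradiction refl u≢w
three-distinct {suc (suc zero)} {0F} {1F} {1F} _ _ v≢w = contradiction refl v≢w
three-distinct {suc (suc zero)} {1F} {0F} {0F} _ _ v≢w = contradiction refl v≢w
three-distinct {suc (suc zero)} {1F} {0F} {1F} _ u≢w _ = contradiction refl u≢w
three-distinct {suc (suc (suc n))} _ _ _ = n , refl

port-distinct : ∀ {x y : Dart n d} → vertex x ≡ vertex y → x ≢ y → port x ≢ port y
port-distinct refl x≢y refl = x≢y refl

triangle-case : ∀ (G : DartGraph n 3) → (∀ {m} → m < n → Claim m) → ∀ {x y z} → Triangle G x y z →
                ∀ w → NoCutEdge G → (∀ v → 1 ≤ w v) → (∀ v → Covered G w v) → FewConflicts 15 G w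
triangle-case {n} G ih {x} {y} {z} t w nce = by (three-distinct u≢a (b≢u ∘ sym) a≢b)
  where
  u≢a : vertex x ≢ vertex y
  u≢a eq = no-loop G nce x (sym (trans eq (xy t)))

  a≢b : vertex y ≢ vertex z
  a≢b eq = no-loop G nce y (sym (trans eq (yz t)))

  b≢u : vertex z ≢ vertex x
  b≢u eq = no-loop G nce z (sym (trans eq (zx t)))

  -- If the triangle left a corner by the dart through which it arrived, it would return along the
  -- same edge, and its first and third corners would coincide.
  turn : ∀ (p q r : Dart n 3) → vertex q ≡ vertex (mate G p) → vertex r ≡ vertex (mate G q) → vertex p ≢ vertex r →
         port q ≢ port (mate G p)
  turn p q r pq qr p≢r = port-distinct {x = q} {mate G p} pq λ q≡p′ → p≢r (sym (trans qr
    (cong vertex (trans (cong (mate G) q≡p′) (mate-involutive G p)))))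

  by : ∃[ m ] n ≡ 3 + m → (∀ v → 1 ≤ w v) → (∀ v → Covered G w v) → FewConflicts 15 G w
  by (m , refl) =
    let (ς , ς0 , ς1)     = perm₂ (turn z x y (zx t) (xy t) (a≢b ∘ sym))
        (σ , σ0 , σ1)     = perm₂ (turn x y z (xy t) (yz t) (b≢u ∘ sym))
        (τ , τ0 , τ1)     = perm₂ (turn y z x (yz t) (zx t) (u≢a ∘ sym))
        (R , R0 , R1 , R2) = relabelling₃ u≢a (b≢u ∘ sym) a≢b ς σ τ
    in relabel-step G R (triangle-step (relabel G R)
      (relabelled-mate G R {x = x} {mate G x} {σ = ς} {σ} R0 ς0 (λ j → trans (R1 j) (cong (_, σ ⟨$⟩ʳ j) (xy t))) σ1 refl)
      (relabelled-mate G R {x = y} {mate G y} {σ = σ} {τ} R1 σ0 (λ j → trans (R2 j) (cong (_, τ ⟨$⟩ʳ j) (yz t))) τ1 refl)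
      (relabelled-mate G R {x = z} {mate G z} {σ = τ} {ς} R2 τ0 (λ j → trans (R0 j) (cong (_, ς ⟨$⟩ʳ j) (zx t))) ς1 refl)
      (ih (m<n⇒m<1+n (n<1+n (suc m))))) w nce

covered-fewConflicts : ∀ n → Claim n
covered-fewConflicts = <-rec Claim λ n ih G w nce pos cov →
  by G ih w nce pos cov (anyDart? λ x → anyDart? λ y → digon? G x y)
    (anyDart? λ x → anyDart? λ y → anyDart? λ z → triangle? G x y z)
  where
  by : ∀ {n} (G : DartGraph n 3) → (∀ {m} → m < n → Claim m) → ∀ w → NoCutEdge G → (∀ v → 1 ≤ w v) →
       (∀ v → Covered G w v) → Dec (∃[ x ] ∃[ y ] Digon G x y) → Dec (∃[ x ] ∃[ y ] ∃[ z ] Triangle G x y z) →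
       FewConflicts 15 G w
  by G ih w nce pos cov (yes (x , y , t)) _ = digon-case G ih t w nce pos cov
  by G ih w nce pos cov (no _) (yes (x , y , z , t)) = triangle-case G ih t w nce pos cov
  by G ih w nce pos cov (no noDigon) (no noTriangle) =
    free-step G w nce heavy λ x y z t → noTriangle (x , y , z , t)
    where
    heavy : ∀ v → 3 ≤ w v
    heavy v with cov v
    ... | inj₁ h                            = h
    ... | inj₂ (inj₁ (x , y , t , _))       = contradiction (x , y , t) noDigon
    ... | inj₂ (inj₂ (x , y , z , t , _))   = contradiction (x , y , z , t) noTriangle

-- Enumerating a subset

private variable
  m k : ℕ

-- Numbers the three edges at a vertex as ports. The field `total` turns a sum over ports into a sum
-- over all edges, as double counting requires.
record Enumeration (p : Subset m) (k : ℕ) : Set where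
  field
    at        : Fin k → Fin m
    injective : ∀ {i j} → at i ≡ at j → i ≡ j
    member    : ∀ i → lookup p (at i) ≡ true
    index     : ∀ {e} → lookup p e ≡ true → ∃[ i ] at i ≡ e
    total     : ∀ g → sum (g ∘ at) ≡ sum λ e → if lookup p e then g e else 0

open Enumeration

enumerate-inside : ∀ {p : Subset m} → Enumeration p k → Enumeration (inside ∷ p) (suc k)
enumerate-inside {m} {k} {p} E = record
  { at        = at′
  ; injective = injective′
  ; member    = member′
  ; index     = index′
  ; total     = λ g → cong (g zero +_) (total E (g ∘ suc))
  }
  where
  at′ : Fin (suc k) → Fin (suc m)
  at′ zero    = zero
  at′ (suc i) = suc (at E i)

  injective′ : ∀ {i j} → at′ i ≡ at′ j → i ≡ j
  injective′ {zero}  {zero}  eq = refl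
  injective′ {suc i} {suc j} eq = cong suc (injective E (suc-injective eq))

  member′ : ∀ i → lookup (inside ∷ p) (at′ i) ≡ true
  member′ zero    = refl
  member′ (suc i) = member E i

  index′ : ∀ {e} → lookup (inside ∷ p) e ≡ true → ∃[ i ] at′ i ≡ e
  index′ {zero}  _  = zero , refl
  index′ {suc e} eq = let (i , at-i) = index E eq in suc i , cong suc at-i

enumerate-outside : ∀ {p : Subset m} → Enumeration p k → Enumeration (outside ∷ p) k
enumerate-outside {m} {k} {p} E = record
  { at        = suc ∘ at E
  ; injective = injective E ∘ suc-injective
  ; member    = member E
  ; index     = index′
  ; total     = λ g → total E (g ∘ suc)
  }
  where
  index′ : ∀ {e} → lookup (outside ∷ p) e ≡ true → ∃[ i ] suc (at E i) ≡ e
  index′ {suc e} eq = let (i , at-i) = index E eq in i , cong suc at-i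

enumerate : ∀ (p : Subset m) → Enumeration p ∣ p ∣
enumerate []            = record
  { at = λ () ; injective = λ {} ; member = λ () ; index = λ {} ; total = λ _ → refl }
enumerate (inside ∷ p)  = enumerate-inside (enumerate p)
enumerate (outside ∷ p) = enumerate-outside (enumerate p)

∣tabulate∣ : ∀ (b : Fin m → Bool) → ∣ tabulate b ∣ ≡ sum λ e → if b e then 1 else 0
∣tabulate∣ {zero}  b = refl
∣tabulate∣ {suc m} b with b zero
... | true  = cong suc (∣tabulate∣ (b ∘ suc))
... | false = ∣tabulate∣ (b ∘ suc)

x∉p-x : ∀ (p : Subset m) x → ¬ x ∈ₛ p - x
x∉p-x (_ ∷ p) zero    ()
x∉p-x (_ ∷ p) (suc x) (_[_]=_.there x∈) = x∉p-x p x x∈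

-- Labelling the components

module _ (G : Graph) where
  open Graph G

  private
    E = Fin numE
    V = Fin numV

  -- Edges are selected by a predicate, which covers both the lists that grow edge by edge and the
  -- subsets in `HasComponents`.
  AdjacentBy : (E → Set) → V → V → Set
  AdjacentBy P u v = ∃[ e ] (P e × Joins G e u v)

  Components : (E → Set) → ℕ → Set
  Components P k = Σ[ c ∈ (V → Fin k) ]
    (StrictlySurjective _≡_ c × (∀ u v → (c u ≡ c v) ⇔ Star (AdjacentBy P) u v))

  components-cong : ∀ {P Q k} → (∀ {e} → P e → Q e) → (∀ {e} → Q e → P e) → Components P k → Components Q k
  components-cong P⊆Q Q⊆P (c , surj , iff) = c , surj , λ u v → mk⇔
    (Star.map (λ (e , p , j) → e , P⊆Q p , j) ∘ Equivalence.to (iff u v))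
    (Equivalence.from (iff u v) ∘ Star.map (λ (e , q , j) → e , Q⊆P q , j))

  constant-on-components : ∀ {A : Set} {P} (f : V → A) → (∀ {e u v} → P e → Joins G e u v → f u ≡ f v) →
                           ∀ {u v} → Star (AdjacentBy P) u v → f u ≡ f v
  constant-on-components f step ε = refl
  constant-on-components f step ((e , p , j) ◅ rest) = trans (step p j) (constant-on-components f step rest)

  joins-sym : ∀ {e u v} → Joins G e u v → Joins G e v u
  joins-sym = Sum.swap

  module _ {P : E → Set} {Q : E → Set} (e : E) (Qe : Q e) (P⊆Q : ∀ {f} → P f → Q f)
           (Q⊆ : ∀ {f} → Q f → f ≡ e ⊎ P f) where

    private
      a = proj₁ (ends e)
      b = proj₂ (ends e)

      extend-path : ∀ {u v} → Star (AdjacentBy P) u v → Star (AdjacentBy Q) u v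
      extend-path = Star.map λ (f , p , j) → f , P⊆Q p , j

      step-within : ∀ {A : Set} (h : V → A) → h a ≡ h b → (∀ {f u v} → P f → Joins G f u v → h u ≡ h v) →
             ∀ {f u v} → Q f → Joins G f u v → h u ≡ h v
      step-within h hab hP q j with Q⊆ q
      ... | inj₂ p = hP p j
      step-within h hab hP q (inj₁ eq) | inj₁ refl =
        trans (cong (h ∘ proj₁) (sym eq)) (trans hab (cong (h ∘ proj₂) eq))
      step-within h hab hP q (inj₂ eq) | inj₁ refl =
        trans (cong (h ∘ proj₂) (sym eq)) (trans (sym hab) (cong (h ∘ proj₁) eq))

    join-components : ∀ {k} ((c , _) : Components P k) → c a ≡ c b → Components Q k
    join-components (c , surj , iff) cab = c , surj , λ u v → mk⇔
      (extend-path ∘ Equivalence.to (iff u v))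
      (constant-on-components c (step-within c cab λ p j → Equivalence.from (iff _ _) ((_ , p , j) ◅ ε)))

    -- The label of `b` is struck out by `punchOut`, and its vertices take the label of `a`. Equal
    -- new labels then mean a path without `e`, or one that uses `e` once.
    merge-components : ∀ {k} ((c , _) : Components P (suc k)) → c a ≢ c b → Components Q k
    merge-components {k} (c , surj , iff) cab = c′ , surj′ , λ u v → mk⇔ (connect u v)
      (constant-on-components c′ (step-within c′ c′ab λ p j →
        cong merge (Equivalence.from (iff _ _) ((_ , p , j) ◅ ε))))
      where
      merge : Fin (suc k) → Fin k
      merge i with i ≟ c b
      ... | yes _  = punchOut (cab ∘ sym)
      ... | no i≢b = punchOut (i≢b ∘ sym)

      c′ : V → Fin k
      c′ = merge ∘ c

      c′ab : c′ a ≡ c′ b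
      c′ab with c a ≟ c b | c b ≟ c b
      ... | yes eq | _       = contradiction eq cab
      ... | no _   | no b≢b  = contradiction refl b≢b
      ... | no _   | yes _   = punchOut-cong (c b) refl

      surj′ : StrictlySurjective _≡_ c′
      surj′ j with surj (punchIn (c b) j)
      ... | u , eq = u , trans (cong merge eq) unmerge
        where
        unmerge : merge (punchIn (c b) j) ≡ j
        unmerge with punchIn (c b) j ≟ c b
        ... | yes eq′ = contradiction eq′ (punchInᵢ≢i (c b) j)
        ... | no ne   = trans (punchOut-cong (c b) refl) (punchOut-punchIn (c b))

      within : ∀ {u v} → c u ≡ c v → Star (AdjacentBy Q) u v
      within eq = extend-path (Equivalence.to (iff _ _) eq)

      a→b : AdjacentBy Q a b
      a→b = e , Qe , inj₁ refl

      b→a : AdjacentBy Q b a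
      b→a = e , Qe , inj₂ refl

      connect : ∀ u v → c′ u ≡ c′ v → Star (AdjacentBy Q) u v
      connect u v eq with c u ≟ c b | c v ≟ c b
      ... | yes u~b | yes v~b = within (trans u~b (sym v~b))
      ... | yes u~b | no v≁b  = within u~b ◅◅ b→a ◅ within (punchOut-injective (cab ∘ sym) (v≁b ∘ sym) eq)
      ... | no u≁b  | yes v~b = within (punchOut-injective (u≁b ∘ sym) (cab ∘ sym) eq) ◅◅ a→b ◅ within (sym v~b)
      ... | no u≁b  | no v≁b  = within (punchOut-injective (u≁b ∘ sym) (v≁b ∘ sym) eq)

  -- Starts from isolated vertices, each its own label, and adds the edges one at a time; an edge
  -- either stays within a class or merges two.
  components : ∀ (L : List E) → ∃[ k ] Components (_∈ₗ L) k
  components [] = numV , (λ v → v) , (λ v → v , refl) , λ u v → mk⇔ (λ { refl → ε })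
    (constant-on-components (λ v → v) λ ())
  components (e ∷ L) with components L
  ... | k , comps@(c , _) with c (proj₁ (ends e)) ≟ c (proj₂ (ends e))
  ... | yes eq = k , join-components e (here refl) there (λ { (here eq) → inj₁ eq ; (there p) → inj₂ p }) comps eq
  components (e ∷ L) | suc k , comps | no ne =
    k , merge-components e (here refl) there (λ { (here eq) → inj₁ eq ; (there p) → inj₂ p }) comps ne
  components (e ∷ L) | zero , comps@(c , _) | no ne with () ← c (proj₁ (ends e))

  private
    others : E → List E
    others e = filter (λ f → ¬? (f ≟ e)) (allFin numE)

    others⁺ : ∀ {e f} → f ∈ₛ ⊤ - e → f ∈ₗ others e
    others⁺ {e} {f} f∈ = ∈-filter⁺ (λ f → ¬? (f ≟ e)) (∈-allFin f) λ { refl → x∉p-x ⊤ f f∈ }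

    others⁻ : ∀ {e f} → f ∈ₗ others e → f ≢ e
    others⁻ {e} f∈ = proj₂ (∈-filter⁻ (λ f → ¬? (f ≟ e)) {xs = allFin numE} f∈)

  -- If a path avoids `e` and joins its ends, `f` is constant along it. Otherwise adding `e` merges
  -- exactly two classes, and the labellings before and after with `suc k` and `k` labels are the
  -- data that make `e` a bridge.
  bridge-invariant : ∀ {A : Set} e → ¬ Bridge G e → (f : V → A) →
    (∀ {g u v} → g ≢ e → Joins G g u v → f u ≡ f v) → f (proj₁ (ends e)) ≡ f (proj₂ (ends e))
  bridge-invariant e ¬bridge f invariant with components (others e)
  ... | k , comps@(c , _ , iff) with c (proj₁ (ends e)) ≟ c (proj₂ (ends e))
  ... | yes eq = constant-on-components f (λ g∈ → invariant (others⁻ g∈)) (Equivalence.to (iff _ _) eq)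
  bridge-invariant e ¬bridge f invariant | zero , (c , _) | no ne with () ← c (proj₁ (ends e))
  bridge-invariant e ¬bridge f invariant | suc k , comps | no ne = contradiction
    (k , suc k , merge-components e ∈⊤ (λ _ → ∈⊤) split comps ne ,
      components-cong (λ g∈ → x∈p∧x≢y⇒x∈p-y ∈⊤ (others⁻ g∈)) others⁺ comps , n<1+n k)
    ¬bridge
    where
    split : ∀ {g} → g ∈ₛ ⊤ → g ≡ e ⊎ g ∈ₗ others e
    split {g} _ with g ≟ e
    ... | yes eq = inj₁ eq
    ... | no ne  = inj₂ (∈-filter⁺ (λ f → ¬? (f ≟ e)) (∈-allFin g) ne)

-- The dart graph of a cubic graph

does-true : {P : Set} (P? : Dec P) → does P? ≡ true → P
does-true (yes p) _ = p

module _ (G : Graph) (cubic : Cubic G) where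
  open Graph G

  private
    V = Fin numV
    E = Fin numE

    incident-lookup : ∀ v e → lookup (edgesAt G v) e ≡ does (incident? G v e)
    incident-lookup v e = lookup∘tabulate _ e

    Dartᴳ = Dart numV 3

  abstract
    ports : ∀ v → Enumeration (edgesAt G v) 3
    ports v = subst (Enumeration (edgesAt G v)) (cubic v) (enumerate (edgesAt G v))

  edge : Dartᴳ → E
  edge (v , k) = at (ports v) k

  edge-incident : ∀ x → Incident G (vertex x) (edge x)
  edge-incident (v , k) = does-true (incident? G v (edge (v , k)))
    (trans (sym (incident-lookup v (edge (v , k)))) (member (ports v) k))

  edge-injective : ∀ {x y} → vertex x ≡ vertex y → edge x ≡ edge y → x ≡ y
  edge-injective {v , k} {.v , l} refl eq = cong (v ,_) (injective (ports v) eq)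

  abstract
    dartAt : ∀ {v e} → Incident G v e → ∃[ x ] (vertex x ≡ v × edge x ≡ e)
    dartAt {v} {e} inc with index (ports v) {e} (trans (incident-lookup v e) (dec-true (incident? G v e) inc))
    ... | k , at-k = (v , k) , refl , at-k

  opposite : ∀ x → ∃[ w ] (Joins G (edge x) (vertex x) w × w ≢ vertex x)
  opposite x with edge-incident x
  ... | inj₁ eq = proj₂ (ends (edge x)) , inj₁ (cong (_, proj₂ (ends (edge x))) eq) ,
    λ w≡v → loopless (edge x) (trans eq (sym w≡v))
  ... | inj₂ eq = proj₁ (ends (edge x)) , inj₂ (cong (proj₁ (ends (edge x)) ,_) eq) ,
    λ w≡v → loopless (edge x) (trans w≡v (sym eq))

  joins-incident : ∀ {e u v} → Joins G e u v → Incident G v e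
  joins-incident (inj₁ eq) = inj₂ (cong proj₂ eq)
  joins-incident (inj₂ eq) = inj₁ (cong proj₁ eq)

  joins-ends : ∀ {e u v w} → Joins G e u v → Incident G w e → w ≡ u ⊎ w ≡ v
  joins-ends (inj₁ eq) (inj₁ w) = inj₁ (trans (sym w) (cong proj₁ eq))
  joins-ends (inj₁ eq) (inj₂ w) = inj₂ (trans (sym w) (cong proj₂ eq))
  joins-ends (inj₂ eq) (inj₁ w) = inj₂ (trans (sym w) (cong proj₁ eq))
  joins-ends (inj₂ eq) (inj₂ w) = inj₁ (trans (sym w) (cong proj₂ eq))

  private abstract
    opposite-dart : ∀ x → ∃[ y ] (edge y ≡ edge x × vertex y ≢ vertex x)
    opposite-dart x =
      let (w , joins , w≢v) = opposite x
          (y , y∈w , ey)    = dartAt (joins-incident joins)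
      in y , ey , λ eq → w≢v (trans (sym y∈w) eq)

    opposite-unique : ∀ {x y z} → edge y ≡ edge x → vertex y ≢ vertex x →
                      edge z ≡ edge x → vertex z ≢ vertex x → y ≡ z
    opposite-unique {x} {y} {z} ey y≢x ez z≢x =
      edge-injective (trans (other-end y ey y≢x) (sym (other-end z ez z≢x))) (trans ey (sym ez))
      where
      other-end : ∀ u → edge u ≡ edge x → vertex u ≢ vertex x → vertex u ≡ proj₁ (opposite x)
      other-end u eu u≢x with joins-ends (proj₁ (proj₂ (opposite x))) (subst (Incident G (vertex u)) eu (edge-incident u))
      ... | inj₁ eq = contradiction eq u≢x
      ... | inj₂ eq = eq

  private
    mateᴳ : Dartᴳ → Dartᴳ
    mateᴳ x = proj₁ (opposite-dart x)

  edge-mate : ∀ x → edge (mateᴳ x) ≡ edge x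
  edge-mate x = proj₁ (proj₂ (opposite-dart x))

  vertex-mate : ∀ x → vertex (mateᴳ x) ≢ vertex x
  vertex-mate x = proj₂ (proj₂ (opposite-dart x))

  mate-unique : ∀ {x y} → edge y ≡ edge x → vertex y ≢ vertex x → mateᴳ x ≡ y
  mate-unique {x} ey y≢x = opposite-unique (edge-mate x) (vertex-mate x) ey y≢x

  darts : DartGraph numV 3
  mate            darts   = mateᴳ
  mate-involutive darts x = mate-unique (sym (edge-mate x)) (vertex-mate x ∘ sym)
  mate-irrefl     darts x = vertex-mate x ∘ cong vertex

  dart-joins : ∀ x → Joins G (edge x) (vertex x) (vertex (mate darts x))
  dart-joins x with opposite x
  ... | w , joins , _ with joins-ends joins (subst (Incident G _) (edge-mate x) (edge-incident (mate darts x)))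
  ... | inj₁ eq = contradiction eq (vertex-mate x)
  ... | inj₂ refl = joins

  joins-distinct : ∀ {e u v} → Joins G e u v → u ≢ v
  joins-distinct {e} (inj₁ eq) refl = loopless e (trans (cong proj₁ eq) (sym (cong proj₂ eq)))
  joins-distinct {e} (inj₂ eq) refl = loopless e (trans (cong proj₁ eq) (sym (cong proj₂ eq)))

  joins-dart : ∀ {e u v} → Joins G e u v → ∃[ x ] (edge x ≡ e × vertex x ≡ u × vertex (mate darts x) ≡ v)
  joins-dart {e} {u} {v} joins with dartAt (joins-incident (joins-sym G joins)) | dartAt (joins-incident joins)
  ... | x , x∈u , ex | y , y∈v , ey = x , ex , x∈u , trans
    (cong vertex (mate-unique (trans ey (sym ex)) λ eq → joins-distinct joins (trans (sym x∈u) (trans (sym eq) y∈v)))) y∈v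

  -- If only one edge crossed, `S` would be constant along all the others, hence by
  -- `bridge-invariant` also along this one.
  noCutEdge-darts : Bridgeless G → NoCutEdge darts
  noCutEdge-darts bridgeless S x ce = crosses ce (ends-equal (dart-joins x))
    where
    level : ∀ {g u v} → g ≢ edge x → Joins G g u v → S u ≡ S v
    level {g} {u} {v} g≢e joins with joins-dart joins | S u Bool.≟ S v
    ... | _ | yes eq = eq
    ... | y , refl , refl , refl | no ne with only ce y ne
    ... | inj₁ refl = contradiction refl g≢e
    ... | inj₂ refl = contradiction (edge-mate x) g≢e

    same : S (proj₁ (ends (edge x))) ≡ S (proj₂ (ends (edge x)))
    same = bridge-invariant G (edge x) (bridgeless (edge x)) S level

    ends-equal : ∀ {u v} → Joins G (edge x) u v → S u ≡ S v
    ends-equal (inj₁ eq) = trans (cong (S ∘ proj₁) (sym eq)) (trans same (cong (S ∘ proj₂) eq))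
    ends-equal (inj₂ eq) = trans (cong (S ∘ proj₂) (sym eq)) (trans (sym same) (cong (S ∘ proj₁) eq))

  -- Without a digon at `v` its three neighbours are distinct, and without a triangle no two of them
  -- are adjacent, so `v` is the centre of an induced claw. Both alternatives are decided by search.
  covered-darts : ClawFree G → ∀ v → Covered darts (λ _ → 1) v
  covered-darts clawFree v = by
    (any? λ k → any? λ l → digon? darts (v , k) (v , l))
    (any? λ k → any? λ l → anyDart? λ y → ¬? (k ≟ l) ×-dec (vertex y ≟ N k) ×-dec (vertex (mate darts y) ≟ N l))
    where
    N : Fin 3 → V
    N k = vertex (mate darts (v , k))

    by : Dec (∃[ k ] ∃[ l ] Digon darts (v , k) (v , l)) →
         Dec (∃[ k ] ∃[ l ] ∃[ y ] (k ≢ l × vertex y ≡ N k × vertex (mate darts y) ≡ N l)) →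
         Covered darts (λ _ → 1) v
    by (yes (k , l , t)) _ = inj₂ (inj₁ ((v , k) , (v , l) , t , refl))
    by (no _) (yes (k , l , y , _ , y∈k , y→l)) = inj₂ (inj₂ ((v , k) , y , mate darts (v , l) , record
      { xy = y∈k ; yz = sym y→l ; zx = cong vertex (sym (mate-involutive darts (v , l))) } , refl))
    by (no noDigon) (no noTriangle) = contradiction claw clawFree
      where
      onV : Fin 4 → V
      onV zero    = v
      onV (suc k) = N k

      onV-injective : ∀ {i j} → onV i ≡ onV j → i ≡ j
      onV-injective {zero}  {zero}  eq = refl
      onV-injective {zero}  {suc l} eq = contradiction (sym eq) (vertex-mate (v , l))
      onV-injective {suc k} {zero}  eq = contradiction eq (vertex-mate (v , k))
      onV-injective {suc k} {suc l} eq with k ≟ l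
      ... | yes refl = refl
      ... | no k≢l   = contradiction
        (k , l , record { distinct = k≢l ∘ cong port ; from-one = refl ; into-one = eq }) noDigon

      at-centre : ∀ y → vertex y ≡ v → ∃[ k ] edge (v , k) ≡ edge y
      at-centre (.v , k) refl = k , refl

      induced : ∀ f i j → Joins G f (onV i) (onV j) → ∃[ k ] edge (v , k) ≡ f
      induced f i j joins with joins-dart joins
      induced f zero    j       joins | y , refl , y∈ , y→ = at-centre y y∈
      induced f (suc k) zero    joins | y , refl , y∈ , y→ =
        let (l , eq) = at-centre (mate darts y) y→ in l , trans eq (edge-mate y)
      induced f (suc k) (suc l) joins | y , refl , y∈ , y→ with k ≟ l
      ... | yes refl = contradiction refl (joins-distinct joins)
      ... | no k≢l   = contradiction (k , l , y , k≢l , y∈ , y→) noTriangle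

      claw : InducedCopy K₁,₃ G
      claw = record
        { onV      = onV
        ; onE      = λ k → edge (v , k)
        ; onV-inj  = onV-injective
        ; onE-inj  = λ eq → cong port (edge-injective {v , _} {v , _} refl eq)
        ; preserve = λ k → dart-joins (v , k)
        ; induced  = induced
        }

  -- Double counting of incidences: the ends of an edge differ, so it is met exactly twice. A
  -- constant `g` gives the handshake lemma.
  sum-incident : ∀ (g : E → ℕ) → sumᴰ (g ∘ edge) ≡ 2 * sum g
  sum-incident g = begin
    sumᴰ (g ∘ edge)                                                      ≡⟨ sum-cong-≗ (λ v → total (ports v) g) ⟩
    sum (λ v → sum λ e → if lookup (edgesAt G v) e then g e else 0)      ≡⟨ ∑-comm (λ v e → if lookup (edgesAt G v) e then g e else 0) ⟩
    sum (λ e → sum λ v → if lookup (edgesAt G v) e then g e else 0)      ≡⟨ sum-cong-≗ both ⟩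
    sum (λ e → g e + g e)                                                ≡⟨ ∑-distrib-+ g g ⟩
    sum g + sum g                                                        ≡⟨ cong (sum g +_) (+-identityʳ (sum g)) ⟨
    2 * sum g                                                            ∎
    where
    open ≡-Reasoning

    at-end : ∀ (u : V) x → sum (λ v → if does (u ≟ v) then x else 0) ≡ x
    at-end u x = trans
      (sum-single (λ v → if does (u ≟ v) then x else 0) u λ v v≢u →
        cong (λ z → if z then x else 0) (dec-false (u ≟ v) (v≢u ∘ sym)))
      (cong (λ z → if z then x else 0) (dec-true (u ≟ u) refl))

    split : ∀ {e x} v → (if lookup (edgesAt G v) e then x else 0) ≡
            (if does (proj₁ (ends e) ≟ v) then x else 0) + (if does (proj₂ (ends e) ≟ v) then x else 0)
    split {e} v rewrite incident-lookup v e with proj₁ (ends e) ≟ v | proj₂ (ends e) ≟ v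
    ... | yes p | yes q = contradiction (trans p (sym q)) (loopless e)
    ... | yes _ | no _  = sym (+-identityʳ _)
    ... | no _  | yes _ = refl
    ... | no _  | no _  = refl

    both : ∀ e → sum (λ v → if lookup (edgesAt G v) e then g e else 0) ≡ g e + g e
    both e = trans (sum-cong-≗ (split {e}))
      (trans (∑-distrib-+ (λ v → if does (proj₁ (ends e) ≟ v) then g e else 0) _)
        (cong₂ _+_ (at-end (proj₁ (ends e)) (g e)) (at-end (proj₂ (ends e)) (g e))))

  module _ (c : Colouring numV 3) where

    private
      start finish : E → Dartᴳ
      start e  = proj₁ (dartAt {proj₁ (ends e)} {e} (inj₁ refl))
      finish e = proj₁ (dartAt {proj₂ (ends e)} {e} (inj₂ refl))

      vertex-start : ∀ e → vertex (start e) ≡ proj₁ (ends e)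
      vertex-start e = proj₁ (proj₂ (dartAt {proj₁ (ends e)} {e} (inj₁ refl)))

      vertex-finish : ∀ e → vertex (finish e) ≡ proj₂ (ends e)
      vertex-finish e = proj₁ (proj₂ (dartAt {proj₂ (ends e)} {e} (inj₂ refl)))

      edge-start : ∀ e → edge (start e) ≡ e
      edge-start e = proj₂ (proj₂ (dartAt {proj₁ (ends e)} {e} (inj₁ refl)))

      edge-finish : ∀ e → edge (finish e) ≡ e
      edge-finish e = proj₂ (proj₂ (dartAt {proj₂ (ends e)} {e} (inj₂ refl)))

      start-mate : ∀ e → mate darts (start e) ≡ finish e
      start-mate e = mate-unique (trans (edge-finish e) (sym (edge-start e)))
        λ eq → loopless e (trans (sym (vertex-start e)) (trans (sym eq) (vertex-finish e)))

      which-end : ∀ x → x ≡ start (edge x) ⊎ x ≡ finish (edge x)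
      which-end x = Sum.map
        (λ eq → edge-injective (trans (sym eq) (sym (vertex-start (edge x)))) (sym (edge-start (edge x))))
        (λ eq → edge-injective (trans (sym eq) (sym (vertex-finish (edge x)))) (sym (edge-finish (edge x))))
        (edge-incident x)

      bad : E → ℕ
      bad e = differ (colour c (start e)) (colour c (finish e))

      conflict-bad : ∀ x → conflict darts c x ≡ bad (edge x)
      conflict-bad x = [ at-start , at-finish ]′ (which-end x)
        where
        e = edge x

        at-start : x ≡ start e → conflict darts c x ≡ bad e
        at-start eq = cong₂ (λ y z → differ (colour c y) (colour c z)) eq (trans (cong (mate darts) eq) (start-mate e))

        at-finish : x ≡ finish e → conflict darts c x ≡ bad e
        at-finish eq = trans (cong₂ (λ y z → differ (colour c y) (colour c z)) eq
          (trans (cong (mate darts) eq) (mate-swap darts (start-mate e)))) (differ-sym (colour c (finish e)) (colour c (start e)))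

      agree : E → Bool
      agree e = does (colour c (start e) ≟ colour c (finish e))

    agreeing : Subset numE
    agreeing = tabulate agree

    ∣agreeing∣ : ∣ agreeing ∣ + sum bad ≡ sum {numE} (λ _ → 1)
    ∣agreeing∣ = trans (cong (_+ sum bad) (∣tabulate∣ agree))
      (trans (sym (∑-distrib-+ (λ e → if agree e then 1 else 0) bad)) (sum-cong-≗ one))
      where
      one : ∀ e → (if agree e then 1 else 0) + bad e ≡ 1
      one e with does (colour c (start e) ≟ colour c (finish e))
      ... | true  = refl
      ... | false = refl

    conflicts-bad : conflicts darts c ≡ 2 * sum bad
    conflicts-bad = trans (sumᴰ-cong {f = conflict darts c} {bad ∘ edge} conflict-bad) (sum-incident bad)

    -- An agreeing edge shows the colour of its first dart at both ends, so two such edges with a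
    -- common vertex inherit the distinct colours of their darts there.
    agreeing-colourable : ThreeEdgeColourable G agreeing
    agreeing-colourable = colour c ∘ start , proper′
      where
      agreed : ∀ {e} → e ∈ₛ agreeing → colour c (start e) ≡ colour c (finish e)
      agreed {e} e∈ = does-true (colour c (start e) ≟ colour c (finish e))
        (trans (sym (lookup∘tabulate agree e)) ([]=⇒lookup e∈))

      colour-at : ∀ {e} → e ∈ₛ agreeing → ∀ {v} → Incident G v e →
                  ∃[ x ] (vertex x ≡ v × edge x ≡ e × colour c x ≡ colour c (start e))
      colour-at {e} e∈ (inj₁ eq) = start e , trans (vertex-start e) eq , edge-start e , refl
      colour-at {e} e∈ (inj₂ eq) = finish e , trans (vertex-finish e) eq , edge-finish e , sym (agreed e∈)

      proper′ : ProperOn G agreeing (colour c ∘ start)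
      proper′ v e f e∈ f∈ e≢f ve vf eq =
        let ((u , k) , u≡v , ex , cx) = colour-at e∈ ve
            ((w , l) , w≡v , ey , cy) = colour-at f∈ vf
        in e≢f (trans (sym ex) (trans (cong edge (same (trans u≡v (sym w≡v)) (trans cx (trans eq (sym cy))))) ey))
        where
        same : ∀ {x y} → vertex x ≡ vertex y → colour c x ≡ colour c y → x ≡ y
        same {u , k} {.u , l} refl eq = cong (u ,_) (proper c eq)

    -- With `B` lost edges and `W` vertices, the hypothesis reads 15 * 2B ≤ 2W. Since 3W is twice
    -- the number of edges, 45B is at most twice that number, and 43 is 45 - 2. Adding 45B to both
    -- sides avoids a truncated subtraction.
    agreeing-size : 15 * conflicts darts c ≤ 2 * sum {numV} (λ _ → 1) → 43 * numE ≤ 45 * ∣ agreeing ∣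
    agreeing-size few = +-cancelʳ-≤ (45 * B) _ _ (begin
      43 * numE + 45 * B    ≤⟨ +-monoʳ-≤ (43 * numE) 45B≤ ⟩
      43 * numE + 2 * numE  ≡⟨ *-distribʳ-+ numE 43 2 ⟨
      45 * numE             ≡⟨ cong (45 *_) (trans (sym (ones numE)) (sym ∣agreeing∣)) ⟩
      45 * (∣ agreeing ∣ + B)       ≡⟨ *-distribˡ-+ 45 ∣ agreeing ∣ B ⟩
      45 * ∣ agreeing ∣ + 45 * B    ∎)
      where
      open ≤-Reasoning
      B W : ℕ
      B = sum bad
      W = sum {numV} (λ _ → 1)

      ones : ∀ n → sum {n} (λ _ → 1) ≡ n
      ones zero    = refl
      ones (suc n) = cong suc (ones n)

      threes : ∀ n → sum {n} (λ _ → 3) ≡ 3 * sum {n} (λ _ → 1)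
      threes zero    = refl
      threes (suc n) = trans (cong (3 +_) (threes n)) (sym (*-distribˡ-+ 3 1 (sum {n} (λ _ → 1))))

      handshake : 3 * W ≡ 2 * numE
      handshake = trans (sym (threes numV)) (trans (sum-incident (λ _ → 1)) (cong (2 *_) (ones numE)))

      45B≤ : 45 * B ≤ 2 * numE
      45B≤ = *-cancelˡ-≤ 2 (begin
        2 * (45 * B)      ≡⟨ solve 1 (λ b → con 2 :* (con 45 :* b) := con 3 :* (con 15 :* (con 2 :* b))) refl B ⟩
        3 * (15 * (2 * B))  ≡⟨ cong (λ i → 3 * (15 * i)) conflicts-bad ⟨
        3 * (15 * conflicts darts c)  ≤⟨ *-monoʳ-≤ 3 few ⟩
        3 * (2 * W)       ≡⟨ solve 1 (λ w → con 3 :* (con 2 :* w) := con 2 :* (con 3 :* w)) refl W ⟩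
        2 * (3 * W)       ≡⟨ cong (2 *_) handshake ⟩
        2 * (2 * numE)    ∎)
        where open +-*-Solver

  colourable-bound : ClawFree G → Bridgeless G → 43 * numE ≤ 45 * ν₃ G
  colourable-bound clawFree bridgeless = ≤-trans (agreeing-size (colouring few) (bound few))
    (*-monoʳ-≤ 45 (proj₂ (ν₃-isMax G) (agreeing (colouring few)) (agreeing-colourable (colouring few))))
    where
    few : FewConflicts 15 darts (λ _ → 1)
    few = covered-fewConflicts numV darts (λ _ → 1) (noCutEdge-darts bridgeless) (λ _ → ≤-refl)
      (covered-darts clawFree)

-- Passage to the rationals

open import Data.Integer using (+_)
open import Data.Rational using (_/_; _≥_)

-- The operation `_/_` reduces fractions, so the comparison is made between unnormalised fractions,
-- where it is a cross multiplication.
/-≥ : ∀ m k a b → a * m ≤ suc b * k → (+ k) / 1 ≥ ((+ a) / suc b) ℚ.* ((+ m) / 1)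
/-≥ m k a b le = ℚ.toℚᵘ-cancel-≤ (begin
  ℚ.toℚᵘ (((+ a) / suc b) ℚ.* ((+ m) / 1))                  ≃⟨ ℚ.toℚᵘ-homo-* ((+ a) / suc b) ((+ m) / 1) ⟩
  ℚ.toℚᵘ ((+ a) / suc b) ℚᵘ.* ℚ.toℚᵘ ((+ m) / 1)           ≃⟨ ℚᵘ.*-cong (ℚ.toℚᵘ-fromℚᵘ (ℚᵘ.mkℚᵘ (+ a) b))
                                                                         (ℚ.toℚᵘ-fromℚᵘ (ℚᵘ.mkℚᵘ (+ m) 0)) ⟩
  ℚᵘ.mkℚᵘ (+ a) b ℚᵘ.* ℚᵘ.mkℚᵘ (+ m) 0                     ≤⟨ ℚᵘ.*≤* le′ ⟩
  ℚᵘ.mkℚᵘ (+ k) 0                                          ≃⟨ ℚ.toℚᵘ-fromℚᵘ (ℚᵘ.mkℚᵘ (+ k) 0) ⟨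
  ℚ.toℚᵘ ((+ k) / 1)                                       ∎)
  where
  open ℚᵘ.≤-Reasoning

  le′ : (+ a ℤ.* + m) ℤ.* + 1 ℤ.≤ + k ℤ.* + (suc b * 1)
  le′ = subst₂ ℤ._≤_ (trans (ℤ.pos-* a m) (sym (ℤ.*-identityʳ _)))
    (trans (cong (λ i → + i) (trans (*-comm (suc b) k) (cong (k *_) (sym (*-identityʳ (suc b)))))) (ℤ.pos-* k (suc b * 1)))
    (ℤ.+≤+ le)

theorem10 : (G : Graph) → ClawFree G → Bridgeless G → Cubic G →
    (+ ν₃ G) / 1 ≥ ((+ 43) / 45) ℚ.* ((+ Graph.numE G) / 1)
theorem10 G clawFree bridgeless cubic = /-≥ (Graph.numE G) (ν₃ G) 43 44 (colourable-bound G cubic clawFree bridgeless)
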